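{- Let $(\Gamma,\alpha)$ be an abstract 1-skeleton of type $(k,n)$ with $\Gamma$ connected such that $\alpha$ is at least three independent (i.e. $l$-independent for some $l$ with $3\le l\le k$). If the intersection of any two faces of dimension less than $3$ in $(\Gamma,\alpha)$ is either connected or empty, then $\Gamma$ is $n$-connected.
   Context: Let $G=(\mathbb{Z}_2)^k$, $k\ge1$. $\mathrm{Hom}(G,\mathbb{Z}_2)$ is regarded as a $k$-dimensional vector space over $\mathbb{Z}_2$ with zero element $\rho_0$. An abstract 1-skeleton of type $(k,n)$ (with $n\ge k$) is a pair $(\Gamma,\alpha)$ where $\Gamma$ is a finite $n$-valent regular graph without loops (multiple edges allowed), with vertex set $V_\Gamma$ and edge set $E_\Gamma$, and $\alpha:E_\Gamma\to\mathrm{Hom}(G,\mathbb{Z}_2)\setminus\{\rho_0\}$ is a map such that, with $E_p$ the set of edges adjacent to the vertex $p$ and $\alpha(E_p)$ the multiset of values of $\alpha$ on $E_p$: (1) for each $p\in V_\Gamma$, $\alpha(E_p)$ spans $\mathrm{Hom}(G,\mathbb{Z}_2)$; (2) for each edge $e$ with endpoints $p,q$, $\alpha(E_p)\equiv\alpha(E_q)\bmod\alpha(e)$, i.e. the two multisets have the same image in $\mathrm{Hom}(G,\mathbb{Z}_2)/\langle\alpha(e)\rangle$. $\alpha$ is $l$-independent if for each vertex $p$ the colors of any $l$ distinct edges in $E_p$ are linearly independent in $\mathrm{Hom}(G,\mathbb{Z}_2)$. For $0\le\ell\le n$, an $\ell$-dimensional face ($\ell$-face) of $(\Gamma,\alpha)$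 is a pair $(\Gamma',\alpha|_{\Gamma'})$ with $\Gamma'$ a connected $\ell$-valent subgraph of $\Gamma$ for which there is a subspace $K$ of $\mathrm{Hom}(G,\mathbb{Z}_2)$ such that (writing $E_p|_{\Gamma'}$ for the edges of $\Gamma'$ adjacent to $p$) (1) for each vertex $p\in V_{\Gamma'}$, $\alpha(E_p|_{\Gamma'})$ spans $K$, and (2) for each edge $e=pq$ of $\Gamma'$, $\alpha(E_p|_{\Gamma'})\equiv\alpha(E_q|_{\Gamma'})\bmod\alpha(e)$ as multisets. Each vertex is a $0$-face. Intersections of faces are intersections of subgraphs (common vertices and common edges). A path in $\Gamma$ with endpoints $a,b$ is a subgraph with vertices $v_0=a,v_1,\dots,v_l=b$ and edges $v_{i-1}v_i$, $i=1,\dots,l$. Two paths with common endpoints $a,b$ are disjoint if their intersection consists of $a$ and $b$ only. A graph is $d$-connected if for every pair of (distinct) vertices there exist $d$ pairwise disjoint paths in it having these vertices as endpoints. -}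

module Defs where

open import Algebra.Bundles using (CommutativeRing; AbelianGroup)
open import Algebra.Module.Bundles using (Module)
open import Algebra.Module.Structures.Biased using (IsModuleFromLeft)
open import Algebra.Morphism.Structures using (module GroupMorphisms)
import Algebra.Construct.Pointwise as Pointwise
import Algebra.Properties.CommutativeMonoid.Sum as Sum
open import Data.Fin.Base using (Fin; zero; suc)
open import Data.Fin.Properties using (_≟_)
open import Data.Fin.Subset using (Subset; _∩_; ⊤) renaming (_∈_ to _∈ˢ_)
open import Data.Fin.Subset.Properties using (∈⊤; x∈p∩q⁺; x∈p∩q⁻) renaming (_∈?_ to _∈ˢ?_)
open import Data.List.Base using (List; []; _∷_; [_]; map; filter; length; lookup; allFin)
open import Data.List.Membership.Propositional using (_∈_)
import Data.List.Relation.Binary.Permutation.Setoid as Permutation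
open import Data.List.Relation.Unary.Unique.Propositional using (Unique)
open import Data.Nat.Base using (ℕ; _≤_)
open import Data.Parity.Base using (Parity; 0ℙ)
import Data.Parity.Properties as ℙ
open import Data.Product.Base using (∃; _×_; _,_; proj₁; proj₂)
open import Data.Sum.Base using (_⊎_)
open import Data.Vec.Functional using (Vector)
open import Function.Base using (_∘_)
open import Function.Bundles using (_⇔_)
open import Function.Definitions using (Injective)
open import Level using (0ℓ) renaming (suc to lsuc)
open import Relation.Binary.Bundles using (Setoid)
open import Relation.Binary.PropositionalEquality using (_≡_; _≢_; refl; sym; trans; cong; cong₂)
import Relation.Binary.Reasoning.Setoid as SetoidReasoning
open import Relation.Nullary.Decidable using (Dec; _⊎-dec_; _×-dec_)
open import Relation.Nullary.Negation using (¬_)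
open import Relation.Unary using (Pred)

------------------------------------------------------------------------
-- The group (ℤ₂)ᵏ and the vector space Hom((ℤ₂)ᵏ, ℤ₂)

ℤ₂ : CommutativeRing 0ℓ 0ℓ
ℤ₂ = ℙ.+-*-commutativeRing

module ℤ₂ = CommutativeRing ℤ₂

ℤ₂^_ : ℕ → AbelianGroup 0ℓ 0ℓ
ℤ₂^ k = Pointwise.abelianGroup (Fin k) ℤ₂.+-abelianGroup

module _ (k : ℕ) where

  private
    module G = AbelianGroup (ℤ₂^ k)

  open GroupMorphisms G.rawGroup (AbelianGroup.rawGroup ℤ₂.+-abelianGroup)
    using (IsGroupHomomorphism)

  record Character : Set where
    constructor character
    field
      ⟦_⟧                 : G.Carrier → Parity
      isGroupHomomorphism : IsGroupHomomorphism ⟦_⟧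

    open IsGroupHomomorphism isGroupHomomorphism public
      using (homo; ε-homo; ⁻¹-homo; ⟦⟧-cong)

  open Character

  private
    mkCharacter : (f : G.Carrier → Parity) →
                  (∀ {x y} → x G.≈ y → f x ≡ f y) →
                  (∀ x y → f (x G.∙ y) ≡ f x ℤ₂.+ f y) →
                  f G.ε ≡ 0ℙ →
                  Character
    mkCharacter f f-cong f-homo f-ε = character f record
      { isMonoidHomomorphism = record
        { isMagmaHomomorphism = record
          { isRelHomomorphism = record { cong = f-cong }
          ; homo              = f-homo
          }
        ; ε-homo = f-ε
        }
      -- negation is the identity, in ℤ₂ and hence pointwise
      ; ⁻¹-homo = λ _ → refl
      }

    +-interchange : ∀ a b c d →
                    (a ℤ₂.+ b) ℤ₂.+ (c ℤ₂.+ d) ≡ (a ℤ₂.+ c) ℤ₂.+ (b ℤ₂.+ d)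
    +-interchange a b c d = trans (ℤ₂.+-assoc a b (c ℤ₂.+ d))
      (trans (cong (a ℤ₂.+_) (trans (sym (ℤ₂.+-assoc b c d))
        (trans (cong (ℤ₂._+ d) (ℤ₂.+-comm b c)) (ℤ₂.+-assoc c b d))))
      (sym (ℤ₂.+-assoc a c (b ℤ₂.+ d))))

  infixl 6 _+ᶜ_
  infixr 7 _·ᶜ_

  _+ᶜ_ : Character → Character → Character
  ρ +ᶜ σ = mkCharacter (λ g → ⟦ ρ ⟧ g ℤ₂.+ ⟦ σ ⟧ g)
    (λ g≈h → cong₂ ℤ₂._+_ (⟦⟧-cong ρ g≈h) (⟦⟧-cong σ g≈h))
    (λ g h → trans (cong₂ ℤ₂._+_ (homo ρ g h) (homo σ g h))
                   (+-interchange (⟦ ρ ⟧ g) _ (⟦ σ ⟧ g) _))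
    (cong₂ ℤ₂._+_ (ε-homo ρ) (ε-homo σ))

  -ᶜ_ : Character → Character
  -ᶜ ρ = mkCharacter (λ g → ℤ₂.- ⟦ ρ ⟧ g) (⟦⟧-cong ρ) (homo ρ) (ε-homo ρ)

  _·ᶜ_ : Parity → Character → Character
  c ·ᶜ ρ = mkCharacter (λ g → c ℤ₂.* ⟦ ρ ⟧ g)
    (λ g≈h → cong (c ℤ₂.*_) (⟦⟧-cong ρ g≈h))
    (λ g h → trans (cong (c ℤ₂.*_) (homo ρ g h)) (ℤ₂.distribˡ c _ _))
    (trans (cong (c ℤ₂.*_) (ε-homo ρ)) (ℤ₂.zeroʳ c))

  ρ₀ : Character
  ρ₀ = mkCharacter (λ _ → 0ℙ) (λ _ → refl) (λ _ _ → refl) refl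

  Hom : Module ℤ₂ 0ℓ 0ℓ
  Hom = record
    { Carrierᴹ = Character
    ; _≈ᴹ_     = λ ρ σ → ∀ g → ⟦ ρ ⟧ g ≡ ⟦ σ ⟧ g
    ; _+ᴹ_     = _+ᶜ_
    ; _*ₗ_     = _·ᶜ_
    ; _*ᵣ_     = λ ρ c → c ·ᶜ ρ
    ; 0ᴹ       = ρ₀
    ; -ᴹ_      = -ᶜ_
    ; isModule = IsModuleFromLeft.isModule {commutativeRing = ℤ₂} record
      { isLeftModule = record
        { isLeftSemimodule = record
          { +ᴹ-isCommutativeMonoid = record
            { isMonoid = record
              { isSemigroup = record
                { isMagma = record
                  { isEquivalence = record
                    { refl  = λ _ → refl
                    ; sym   = λ p g → sym (p g)
                    ; trans = λ p q g → trans (p g) (q g)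
                    }
                  ; ∙-cong = λ p q g → cong₂ ℤ₂._+_ (p g) (q g)
                  }
                ; assoc = λ ρ σ τ g → ℤ₂.+-assoc (⟦ ρ ⟧ g) (⟦ σ ⟧ g) (⟦ τ ⟧ g)
                }
              ; identity = (λ ρ g → ℤ₂.+-identityˡ (⟦ ρ ⟧ g))
                         , (λ ρ g → ℤ₂.+-identityʳ (⟦ ρ ⟧ g))
              }
            ; comm = λ ρ σ g → ℤ₂.+-comm (⟦ ρ ⟧ g) (⟦ σ ⟧ g)
            }
          ; isPreleftSemimodule = record
            { *ₗ-cong      = λ p q g → cong₂ ℤ₂._*_ p (q g)
            ; *ₗ-zeroˡ     = λ ρ g → ℤ₂.zeroˡ (⟦ ρ ⟧ g)
            ; *ₗ-distribʳ  = λ ρ c d g → ℤ₂.distribʳ (⟦ ρ ⟧ g) c d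
            ; *ₗ-identityˡ = λ ρ g → ℤ₂.*-identityˡ (⟦ ρ ⟧ g)
            ; *ₗ-assoc     = λ c d ρ g → ℤ₂.*-assoc c d (⟦ ρ ⟧ g)
            ; *ₗ-zeroʳ     = λ c g → ℤ₂.zeroʳ c
            ; *ₗ-distribˡ  = λ c ρ σ g → ℤ₂.distribˡ c (⟦ ρ ⟧ g) (⟦ σ ⟧ g)
            }
          }
        ; -ᴹ‿cong    = λ p g → cong ℤ₂.-_ (p g)
        ; -ᴹ‿inverse = (λ ρ g → ℤ₂.-‿inverseˡ (⟦ ρ ⟧ g))
                     , (λ ρ g → ℤ₂.-‿inverseʳ (⟦ ρ ⟧ g))
        }
      }
    }

------------------------------------------------------------------------
-- Linear algebra over ℤ₂

module LinearAlgebra (M : Module ℤ₂ 0ℓ 0ℓ) where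

  open Module M
  open Sum +ᴹ-commutativeMonoid using (sum; sum-cong-≋; ∑-distrib-+)

  linComb : ∀ {n} → Vector Parity n → Vector Carrierᴹ n → Carrierᴹ
  linComb c v = sum (λ i → c i *ₗ v i)

  LinearlyIndependent : ∀ {n} → Vector Carrierᴹ n → Set
  LinearlyIndependent v = ∀ c → linComb c v ≈ᴹ 0ᴹ → ∀ i → c i ≡ 0ℙ

  Span : List Carrierᴹ → Pred Carrierᴹ 0ℓ
  Span xs x = ∃ λ (c : Vector Parity (length xs)) → linComb c (lookup xs) ≈ᴹ x

  record IsSubspace (K : Pred Carrierᴹ 0ℓ) : Set where
    field
      resp-≈    : ∀ {x y} → x ≈ᴹ y → K x → K y
      0ᴹ-closed : K 0ᴹ
      +ᴹ-closed : ∀ {x y} → K x → K y → K (x +ᴹ y)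
      *ₗ-closed : ∀ c {x} → K x → K (c *ₗ x)

  _Spans_ : List Carrierᴹ → Pred Carrierᴹ 0ℓ → Set
  xs Spans K = ∀ x → K x ⇔ Span xs x

  private
    linComb-0 : ∀ {n} (v : Vector Carrierᴹ n) → linComb (λ _ → 0ℙ) v ≈ᴹ 0ᴹ
    linComb-0 {ℕ.zero}  v = ≈ᴹ-refl
    linComb-0 {ℕ.suc n} v = ≈ᴹ-trans
      (+ᴹ-cong (*ₗ-zeroˡ (v zero)) (linComb-0 (v ∘ suc))) (+ᴹ-identityˡ 0ᴹ)

    linComb-* : ∀ {n} d (c : Vector Parity n) v →
                linComb (λ i → d ℤ₂.* c i) v ≈ᴹ d *ₗ linComb c v
    linComb-* {ℕ.zero}  d c v = ≈ᴹ-sym (*ₗ-zeroʳ d)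
    linComb-* {ℕ.suc n} d c v = ≈ᴹ-trans
      (+ᴹ-cong (*ₗ-assoc d (c zero) (v zero)) (linComb-* d (c ∘ suc) (v ∘ suc)))
      (≈ᴹ-sym (*ₗ-distribˡ d _ _))

  Span-isSubspace : ∀ xs → IsSubspace (Span xs)
  Span-isSubspace xs = record
    { resp-≈    = λ { x≈y (c , p) → c , ≈ᴹ-trans p x≈y }
    ; 0ᴹ-closed = (λ _ → 0ℙ) , linComb-0 (lookup xs)
    ; +ᴹ-closed = λ { (c , p) (d , q) → (λ i → c i ℤ₂.+ d i)
                    , ≈ᴹ-trans (sum-cong-≋ (λ i → *ₗ-distribʳ (lookup xs i) (c i) (d i)))
                        (≈ᴹ-trans (∑-distrib-+ (λ i → c i *ₗ lookup xs i)
                                               (λ i → d i *ₗ lookup xs i))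
                                  (+ᴹ-cong p q)) }
    ; *ₗ-closed = λ { d (c , p) → (λ i → d ℤ₂.* c i)
                    , ≈ᴹ-trans (linComb-* d c (lookup xs)) (*ₗ-cong refl p) }
    }

  module _ {K : Pred Carrierᴹ 0ℓ} (isSubspace : IsSubspace K) where

    open IsSubspace isSubspace
    open SetoidReasoning ≈ᴹ-setoid

    private
      x+x≈0 : ∀ x → x +ᴹ x ≈ᴹ 0ᴹ
      x+x≈0 x = begin
        x +ᴹ x                   ≈⟨ +ᴹ-cong (*ₗ-identityˡ x) (*ₗ-identityˡ x) ⟨
        ℤ₂.1# *ₗ x +ᴹ ℤ₂.1# *ₗ x ≈⟨ *ₗ-distribʳ x ℤ₂.1# ℤ₂.1# ⟨
        0ℙ *ₗ x                  ≈⟨ *ₗ-zeroˡ x ⟩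
        0ᴹ                       ∎

      -x≈x : ∀ x → -ᴹ x ≈ᴹ x
      -x≈x x = begin
        -ᴹ x               ≈⟨ +ᴹ-identityʳ (-ᴹ x) ⟨
        -ᴹ x +ᴹ 0ᴹ         ≈⟨ +ᴹ-cong ≈ᴹ-refl (x+x≈0 x) ⟨
        -ᴹ x +ᴹ (x +ᴹ x)   ≈⟨ +ᴹ-assoc (-ᴹ x) x x ⟨
        -ᴹ x +ᴹ x +ᴹ x     ≈⟨ +ᴹ-cong (-ᴹ‿inverseˡ x) ≈ᴹ-refl ⟩
        0ᴹ +ᴹ x            ≈⟨ +ᴹ-identityˡ x ⟩
        x                  ∎

      sym-lemma : ∀ x y → x +ᴹ -ᴹ y ≈ᴹ y +ᴹ -ᴹ x
      sym-lemma x y = begin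
        x +ᴹ -ᴹ y ≈⟨ +ᴹ-cong (≈ᴹ-sym (-x≈x x)) (-x≈x y) ⟩
        -ᴹ x +ᴹ y ≈⟨ +ᴹ-comm (-ᴹ x) y ⟩
        y +ᴹ -ᴹ x ∎

      trans-lemma : ∀ x y z → (x +ᴹ -ᴹ y) +ᴹ (y +ᴹ -ᴹ z) ≈ᴹ x +ᴹ -ᴹ z
      trans-lemma x y z = begin
        (x +ᴹ -ᴹ y) +ᴹ (y +ᴹ -ᴹ z) ≈⟨ +ᴹ-assoc x (-ᴹ y) _ ⟩
        x +ᴹ (-ᴹ y +ᴹ (y +ᴹ -ᴹ z)) ≈⟨ +ᴹ-cong ≈ᴹ-refl (+ᴹ-assoc (-ᴹ y) y _) ⟨
        x +ᴹ ((-ᴹ y +ᴹ y) +ᴹ -ᴹ z) ≈⟨ +ᴹ-cong ≈ᴹ-refl (+ᴹ-cong (-ᴹ‿inverseˡ y) ≈ᴹ-refl) ⟩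
        x +ᴹ (0ᴹ +ᴹ -ᴹ z)          ≈⟨ +ᴹ-cong ≈ᴹ-refl (+ᴹ-identityˡ _) ⟩
        x +ᴹ -ᴹ z                  ∎

    quotient : Setoid 0ℓ 0ℓ
    quotient = record
      { Carrier       = Carrierᴹ
      ; _≈_           = λ x y → K (x +ᴹ -ᴹ y)
      ; isEquivalence = record
        { refl  = λ {x} → resp-≈ (≈ᴹ-sym (-ᴹ‿inverseʳ x)) 0ᴹ-closed
        ; sym   = λ {x} {y} → resp-≈ (sym-lemma x y)
        ; trans = λ {x} {y} {z} p q → resp-≈ (trans-lemma x y z) (+ᴹ-closed p q)
        }
      }

  -- Multisets are lists up to permutation, so equality of multisets in the
  -- quotient by ⟨ z ⟩ is permutation up to the quotient equality.
  _≡_mod⟨_⟩ : List Carrierᴹ → List Carrierᴹ → Carrierᴹ → Set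
  xs ≡ ys mod⟨ z ⟩ = xs ↭ ys
    where open Permutation (quotient (Span-isSubspace [ z ])) using (_↭_)

------------------------------------------------------------------------
-- Finite multigraphs without loops

-- The order of the two endpoints of an edge carries no meaning: every notion
-- below is invariant under exchanging src and tgt at any edge.
record Graph : Set where
  field
    #V #E    : ℕ
    src tgt  : Fin #E → Fin #V
    loopless : ∀ e → src e ≢ tgt e

  V E : Set
  V = Fin #V
  E = Fin #E

  Incident : V → E → Set
  Incident p e = src e ≡ p ⊎ tgt e ≡ p

  incident? : ∀ p e → Dec (Incident p e)
  incident? p e = (src e ≟ p) ⊎-dec (tgt e ≟ p)

  Joins : E → V → V → Set
  Joins e p q = (src e ≡ p × tgt e ≡ q) ⊎ (src e ≡ q × tgt e ≡ p)

  record Subgraph : Set where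
    field
      vertices : Subset #V
      edges    : Subset #E
      closed   : ∀ {e} → e ∈ˢ edges → src e ∈ˢ vertices × tgt e ∈ˢ vertices

  open Subgraph

  whole : Subgraph
  whole = record { vertices = ⊤ ; edges = ⊤ ; closed = λ _ → ∈⊤ , ∈⊤ }

  _⊓_ : Subgraph → Subgraph → Subgraph
  H ⊓ H′ = record
    { vertices = vertices H ∩ vertices H′
    ; edges    = edges H ∩ edges H′
    ; closed   = λ e∈ →
        let e∈H , e∈H′ = x∈p∩q⁻ (edges H) (edges H′) e∈
            s , t      = closed H e∈H
            s′ , t′    = closed H′ e∈H′
        in x∈p∩q⁺ (s , s′) , x∈p∩q⁺ (t , t′)
    }

  edgesAt : Subgraph → V → List E
  edgesAt H p = filter (λ e → incident? p e ×-dec (e ∈ˢ? edges H)) (allFin #E)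

  Regular : ℕ → Subgraph → Set
  Regular d H = ∀ p → p ∈ˢ vertices H → length (edgesAt H p) ≡ d

  data Walk (H : Subgraph) : V → V → Set where
    nil  : ∀ {p} → p ∈ˢ vertices H → Walk H p p
    cons : ∀ {p q r} (e : E) → e ∈ˢ edges H → Joins e p q → Walk H q r → Walk H p r

  walkVertices : ∀ {H p q} → Walk H p q → List V
  walkVertices (nil {p} _)        = p ∷ []
  walkVertices (cons {p} _ _ _ w) = p ∷ walkVertices w

  walkEdges : ∀ {H p q} → Walk H p q → List E
  walkEdges (nil _)        = []
  walkEdges (cons e _ _ w) = e ∷ walkEdges w

  record Path (H : Subgraph) (p q : V) : Set where
    field
      walk     : Walk H p q
      distinct : Unique (walkVertices walk)

    pathVertices : List V
    pathVertices = walkVertices walk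

    pathEdges : List E
    pathEdges = walkEdges walk

  open Path

  Empty : Subgraph → Set
  Empty H = ∀ p → ¬ (p ∈ˢ vertices H)

  Connected : Subgraph → Set
  Connected H = ∃ (_∈ˢ vertices H)
              × (∀ p q → p ∈ˢ vertices H → q ∈ˢ vertices H → Path H p q)

  -- The condition on edges matters for adjacent p and q: a one-edge path is
  -- not disjoint from itself.
  Disjoint : ∀ {H p q} → Path H p q → Path H p q → Set
  Disjoint {_} {p} {q} P Q =
      (∀ v → v ∈ pathVertices P → v ∈ pathVertices Q → v ≡ p ⊎ v ≡ q)
    × (∀ e → e ∈ pathEdges P → ¬ (e ∈ pathEdges Q))

  MultiplyConnected : ℕ → Set
  MultiplyConnected d = ∀ p q → p ≢ q →
    ∃ λ (P : Fin d → Path whole p q) → ∀ i j → i ≢ j → Disjoint (P i) (P j)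

------------------------------------------------------------------------
-- Abstract 1-skeletons and their faces

module _ {k : ℕ} (Γ : Graph) (α : Graph.E Γ → Character k) where

  open Graph Γ
  open Subgraph
  open LinearAlgebra (Hom k)

  colours : Subgraph → V → List (Character k)
  colours H p = map α (edgesAt H p)

  SpansAtVertices : Subgraph → Pred (Character k) 0ℓ → Set
  SpansAtVertices H K = ∀ p → p ∈ˢ vertices H → colours H p Spans K

  CongruentAlongEdges : Subgraph → Set
  CongruentAlongEdges H = ∀ e → e ∈ˢ edges H →
    colours H (src e) ≡ colours H (tgt e) mod⟨ α e ⟩

record Skeleton (k n : ℕ) : Set where
  field
    1≤k : 1 ≤ k
    k≤n : k ≤ n
    Γ   : Graph

  open Graph Γ public

  field
    α         : E → Character k
    α≉ρ₀      : ∀ e → Module._≉ᴹ_ (Hom k) (α e) (ρ₀ k)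
    regular   : Regular n whole
    spanning  : ∀ p ρ → LinearAlgebra.Span (Hom k) (colours Γ α whole p) ρ
    congruent : CongruentAlongEdges Γ α whole

module _ {k n : ℕ} (S : Skeleton k n) where

  open Skeleton S
  open LinearAlgebra (Hom k)

  Independent : ℕ → Set
  Independent l = ∀ p (e : Fin l → E) → Injective _≡_ _≡_ e →
    (∀ i → Incident p (e i)) → LinearlyIndependent (α ∘ e)

  record Face (d : ℕ) : Set (lsuc 0ℓ) where
    field
      d≤n        : d ≤ n
      subgraph   : Subgraph
      connected  : Connected subgraph
      valent     : Regular d subgraph
      K          : Pred (Character k) 0ℓ
      isSubspace : IsSubspace K
      spanning   : SpansAtVertices Γ α subgraph K
      congruent  : CongruentAlongEdges Γ α subgraph

  _∩ᶠ_ : ∀ {d d′} → Face d → Face d′ → Subgraph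
  F ∩ᶠ F′ = Face.subgraph F ⊓ Face.subgraph F′

{-# OPTIONS --safe #-}
module Submission where

-- Two edges at a vertex q span a plane of colours, and by 3-independence the
-- edges with colours in that plane form, around q, a cycle: a 2-face.  As 2-faces
-- meet in connected sets, the 2-faces through q meet pairwise in q alone or in a
-- single edge at q.  The 2-faces through an edge e = pq thus give n disjoint
-- paths from p to q, and if a - q - b is a path, then it, the 2-face of its two
-- edges and the 2-faces pairing these with a third edge at q give n disjoint
-- walks from a to b.  Hence a walk avoiding fewer than n - 1 vertices can be
-- rerouted around one more, so fewer than n vertices never separate, and
-- Menger's theorem handles nonadjacent vertices.

open import Defs
open import Data.Nat.Base using (ℕ; _≤_; _<_)
open import Data.Product.Base using (∃; _×_)
open import Data.Sum.Base using (_⊎_)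

open import Algebra.Module.Bundles using (Module)
import Algebra.Properties.CommutativeMonoid.Sum as Sum
open import Data.Bool.Base using (true; false; if_then_else_)
open import Data.Empty using (⊥; ⊥-elim)
open import Data.Fin.Base using (Fin; zero; suc; inject≤; punchOut)
open import Data.Fin.Properties using (_≟_; any?; inject≤-injective; punchOut-injective; injective⇒≤; pigeonhole; <⇒≢)
open import Data.Fin.Subset using (Subset) renaming (_∈_ to _∈ˢ_)
open import Data.Fin.Subset.Properties using (∈⊤; x∈p∩q⁺; x∈p∩q⁻) renaming (_∈?_ to _∈ˢ?_)
open import Data.List.Base using (List; []; _∷_; [_]; length; lookup; filter; map; tabulate; allFin; cartesianProduct)
import Data.List.Membership.DecPropositional as DecMembership
open import Data.List.Membership.Propositional using (_∈_; _∉_; find)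
open import Data.List.Membership.Propositional.Properties using (∈-filter⁺; ∈-filter⁻; ∈-allFin; ∈-lookup; ∈-cartesianProduct⁺; ∈-map⁺; ∈-map⁻; ∈-tabulate⁺)
open import Data.List.Properties using (length-map; length-filter; length-tabulate; filter-≐)
import Data.List.Relation.Binary.Permutation.Setoid as Permutation
import Data.List.Relation.Binary.Permutation.Setoid.Properties as PermutationProperties
open import Data.List.Relation.Unary.All as All using ([]; _∷_)
open import Data.List.Relation.Unary.All.Properties using (¬Any⇒All¬)
open import Data.List.Relation.Unary.AllPairs using ([]; _∷_)
open import Data.List.Relation.Unary.Any as Any using (Any; here; there)
open import Data.List.Relation.Unary.Any.Properties using (lookup-index)
open import Data.List.Relation.Unary.Unique.Propositional using (Unique)
open import Data.List.Relation.Unary.Unique.Propositional.Properties using (allFin⁺) renaming (filter⁺ to Unique-filter⁺)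
open import Data.Nat.Base using (zero; suc; parity; _+_; s≤s; z≤n)
open import Data.Nat.Properties using (_≤?_; _<?_; ≰⇒>; <-irrefl; ≤-refl; ≤-reflexive; ≤-trans; ≤-antisym; ≮⇒≥; <⇒≤; ≤-<-trans; m≤m+n)
open import Data.Parity.Base using (Parity; 0ℙ; 1ℙ) renaming (_+_ to infixl 6 _⊕_; _*_ to infixl 7 _⊗_)
import Data.Parity.Properties as ℙ
open import Data.Product.Base using (∃₂; _,_; proj₁; proj₂)
open import Data.Sum.Base using (inj₁; inj₂; [_,_]′; swap)
open import Data.Vec.Base as Vec using (Vec; []; _∷_)
open import Data.Vec.Functional using (Vector) renaming (_∷_ to _∷ᶠ_)
open import Data.Vec.Properties using (lookup∘tabulate; lookup⇒[]=; []=⇒lookup)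
open import Function.Base using (_∘_; id; flip)
open import Function.Bundles using (_⇔_; Equivalence; mk⇔)
open import Function.Definitions using (Injective)
open import Level using (0ℓ)
open import Relation.Binary.Bundles using (Setoid)
open import Relation.Binary.Construct.Closure.ReflexiveTransitive as Star using (Star; ε; _◅_; _◅◅_)
open import Relation.Binary.Core using (Rel; _⇒_)
import Relation.Binary.Definitions as B
open import Relation.Binary.PropositionalEquality using (_≡_; _≢_; refl; sym; trans; cong; cong₂; subst; subst₂; module ≡-Reasoning)
open import Relation.Nullary.Decidable using (Dec; does; yes; no; map′; _×-dec_; _⊎-dec_; ¬?; dec-true; decidable-stable)
open import Relation.Nullary.Negation using (¬_; contradiction)
open import Relation.Unary using (Pred; Decidable; _⊆′_)

-- Menger's theorem

lookup-injective : ∀ {A : Set} {xs : List A} → Unique xs → Injective _≡_ _≡_ (lookup xs)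
lookup-injective (_ ∷ _)  {zero}  {zero}  _  = refl
lookup-injective (px ∷ _) {zero}  {suc j} eq = contradiction eq (All.lookup px (∈-lookup j))
lookup-injective (px ∷ _) {suc i} {zero}  eq = contradiction (sym eq) (All.lookup px (∈-lookup i))
lookup-injective (_ ∷ u)  {suc i} {suc j} eq = cong suc (lookup-injective u eq)

injective⇒surjective : ∀ {n} {f : Fin n → Fin n} → Injective _≡_ _≡_ f → ∀ j → ∃ λ i → f i ≡ j
injective⇒surjective {suc n} {f} inj j with any? (λ i → f i ≟ j)
... | yes hit = hit
... | no miss = contradiction
  (injective⇒≤ {f = λ i → punchOut (λ eq → miss (i , sym eq))}
    (λ {i} {i′} → inj ∘ punchOut-injective (λ eq → miss (i , sym eq)) (λ eq → miss (i′ , sym eq))))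
  (<-irrefl refl)

module _ {N : ℕ} where

  private
    V : Set
    V = Fin N

  infix 4 _On_ _On?_

  -- Walks here belong to an arbitrary relation on `Fin N`, because reachability and Menger's
  -- theorem are needed for adjacency, for adjacency off a vertex, and for edges with colours in a
  -- subspace.
  _On_ : ∀ {R : Rel V 0ℓ} {a b} → V → Star R a b → Set
  _On_ {a = a} v ε       = v ≡ a
  _On_ {a = a} v (_ ◅ w) = v ≡ a ⊎ v On w

  _On?_ : ∀ {R : Rel V 0ℓ} {a b} v (w : Star R a b) → Dec (v On w)
  _On?_ {a = a} v ε       = v ≟ a
  _On?_ {a = a} v (_ ◅ w) = (v ≟ a) ⊎-dec (v On? w)

  module _ {R : Rel V 0ℓ} where

    On-start : ∀ {a b} (w : Star R a b) → a On w
    On-start ε       = refl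
    On-start (_ ◅ _) = inj₁ refl

    On-end : ∀ {a b} (w : Star R a b) → b On w
    On-end ε       = refl
    On-end (_ ◅ w) = inj₂ (On-end w)

    On-◅◅⁻ : ∀ {a b c v} (w : Star R a b) {w′ : Star R b c} → v On w ◅◅ w′ → v On w ⊎ v On w′
    On-◅◅⁻ ε       on        = inj₂ on
    On-◅◅⁻ (_ ◅ w) (inj₁ eq) = inj₁ (inj₁ eq)
    On-◅◅⁻ (_ ◅ w) (inj₂ on) = [ inj₁ ∘ inj₂ , inj₂ ]′ (On-◅◅⁻ w on)

    On-map⁻ : ∀ {R′ : Rel V 0ℓ} (f : R ⇒ R′) {a b v} (w : Star R a b) → v On Star.map f w → v On w
    On-map⁻ f ε       on        = on
    On-map⁻ f (_ ◅ w) (inj₁ eq) = inj₁ eq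
    On-map⁻ f (_ ◅ w) (inj₂ on) = inj₂ (On-map⁻ f w on)

    prefix : ∀ {a b v} (w : Star R a b) → v On w → ∃ λ (w′ : Star R a v) → ∀ u → u On w′ → u On w
    prefix ε       refl        = ε , λ _ on → on
    prefix (r ◅ w) (inj₁ refl) = ε , λ { _ refl → inj₁ refl }
    prefix (r ◅ w) (inj₂ on)   = let w′ , sub = prefix w on in
      r ◅ w′ , λ { u (inj₁ eq) → inj₁ eq ; u (inj₂ on′) → inj₂ (sub u on′) }

    suffix : ∀ {a b v} (w : Star R a b) → v On w → ∃ λ (w′ : Star R v b) → ∀ u → u On w′ → u On w
    suffix ε       refl        = ε , λ _ on → on
    suffix (r ◅ w) (inj₁ refl) = r ◅ w , λ _ on → on
    suffix (r ◅ w) (inj₂ on)   = let w′ , sub = suffix w on in w′ , λ u → inj₂ ∘ sub u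

    -- A walk stopped at its first visit to `b` contains `b` at its end only. Hence the part up to
    -- `v` can meet `b` only if `v` is `b`, which is what `approach` of a `LinkageTo` requires.
    firstVisit : ∀ {a b} (w : Star R a b) → ∃ λ (w′ : Star R a b) → (∀ u → u On w′ → u On w) ×
      (∀ {v} → v On w′ → ∃ λ (w″ : Star R a v) → ∀ u → u On w″ → u On w × (u ≡ b → v ≡ b))
    firstVisit ε = ε , (λ _ on → on) , λ { refl → ε , λ { _ refl → refl , λ _ → refl } }
    firstVisit {a} {b} (r ◅ w) with a ≟ b
    ... | yes refl = ε , (λ { _ refl → inj₁ refl }) ,
                     λ { refl → ε , λ { _ refl → inj₁ refl , λ _ → refl } }
    ... | no a≢b with firstVisit w
    ...   | w′ , sub , pre = r ◅ w′ ,
      (λ { u (inj₁ eq) → inj₁ eq ; u (inj₂ on) → inj₂ (sub u on) }) ,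
      λ { (inj₁ refl) → ε , (λ { _ refl → inj₁ refl , id })
        ; (inj₂ on) → let w″ , p = pre on in
            r ◅ w″ , λ { u (inj₁ refl) → inj₁ refl , λ eq → contradiction eq a≢b
                       ; u (inj₂ on′) → inj₂ (proj₁ (p u on′)) , proj₂ (p u on′) } }

  module _ {R R′ : Rel V 0ℓ} (f : ∀ {u v} → R u v → R′ v u) where

    On-revApp⁻ : ∀ {a b c v} (w : Star R b a) (w′ : Star R′ b c) →
                 v On Star.revApp f w w′ → v On w ⊎ v On w′
    On-revApp⁻ ε       w′ on = inj₂ on
    On-revApp⁻ (r ◅ w) w′ on with On-revApp⁻ w (f r ◅ w′) on
    ... | inj₁ on₁         = inj₁ (inj₂ on₁)
    ... | inj₂ (inj₁ refl) = inj₁ (inj₂ (On-start w))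
    ... | inj₂ (inj₂ on₂)  = inj₂ on₂

    On-reverse⁻ : ∀ {a b v} (w : Star R a b) → v On Star.reverse f w → v On w
    On-reverse⁻ w on = [ id , (λ { refl → On-start w }) ]′ (On-revApp⁻ w ε on)

  record Linkage (R : Rel V 0ℓ) (A B : Pred V 0ℓ) (s : ℕ) : Set where
    field
      {start end}  : Fin s → V
      walk         : ∀ i → Star R (start i) (end i)
      start∈A      : ∀ i → A (start i)
      end∈B        : ∀ i → B (end i)
      disjoint     : ∀ i j v → v On walk i → v On walk j → i ≡ j

  Separates : Rel V 0ℓ → Pred V 0ℓ → Pred V 0ℓ → ∀ {m} → (Fin m → V) → Set
  Separates R A B S = ∀ {a b} (w : Star R a b) → A a → B b → ∃ λ j → S j On w

  Image : ∀ {m} → (Fin m → V) → Pred V 0ℓ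
  Image S v = ∃ λ j → S j ≡ v

  image? : ∀ {m} (S : Fin m → V) → Decidable (Image S)
  image? S v = any? λ j → S j ≟ v

  mapLinkage : ∀ {R R′ A B s} → R ⇒ R′ → Linkage R A B s → Linkage R′ A B s
  mapLinkage f L = record
    { walk     = Star.map f ∘ walk
    ; start∈A  = start∈A
    ; end∈B    = end∈B
    ; disjoint = λ i j v on on′ → disjoint i j v (On-map⁻ f (walk i) on) (On-map⁻ f (walk j) on′)
    } where open Linkage L

  reverseLinkage : ∀ {R A B s} → Linkage R A B s → Linkage (flip R) B A s
  reverseLinkage L = record
    { walk     = λ i → Star.reverse id (walk i)
    ; start∈A  = end∈B
    ; end∈B    = start∈A
    ; disjoint = λ i j v on on′ → disjoint i j v (On-reverse⁻ id (walk i) on) (On-reverse⁻ id (walk j) on′)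
    } where open Linkage L

  -- The form in which two linkages can be glued: walk `i` ends at target `P i`, and `approach`
  -- reaches any vertex of a walk without touching a target earlier on.
  record LinkageTo (R : Rel V 0ℓ) (A : Pred V 0ℓ) {s} (P : Fin s → V) : Set where
    field
      {start}  : Fin s → V
      walk     : ∀ i → Star R (start i) (P i)
      start∈A  : ∀ i → A (start i)
      disjoint : ∀ i j v → v On walk i → v On walk j → i ≡ j
      approach : ∀ i {v} → v On walk i →
                 ∃ λ (w : Star R (start i) v) → ∀ j → P j On w → v ≡ P j

  module _ {R : Rel V 0ℓ} {A : Pred V 0ℓ} {s} {P : Fin s → V} (L : Linkage R A (Image P) s) where

    open Linkage L

    private
      target-injective : Injective _≡_ _≡_ (proj₁ ∘ end∈B)
      target-injective {i} {i′} eq = disjoint i i′ (end i) (On-end (walk i))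
        (subst (_On walk i′)
          (trans (sym (proj₂ (end∈B i′))) (trans (cong P (sym eq)) (proj₂ (end∈B i))))
          (On-end (walk i′)))

      ι : Fin s → Fin s
      ι j = proj₁ (injective⇒surjective target-injective j)

      end-ι : ∀ j → end (ι j) ≡ P j
      end-ι j = trans (sym (proj₂ (end∈B (ι j)))) (cong P (proj₂ (injective⇒surjective target-injective j)))

      ι-injective : ∀ {i j} → ι i ≡ ι j → i ≡ j
      ι-injective {i} {j} eq = trans (sym (proj₂ (injective⇒surjective target-injective i)))
        (trans (cong (proj₁ ∘ end∈B) eq) (proj₂ (injective⇒surjective target-injective j)))

      retarget : ∀ {a b c} → b ≡ c → (w : Star R a b) →
                 ∃ λ (w′ : Star R a c) → ∀ {v} → v On w′ → v On w
      retarget refl w = w , id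

      first : ∀ j → _
      first j = firstVisit (proj₁ (retarget (end-ι j) (walk (ι j))))

      On-first⁻ : ∀ j {v} → v On proj₁ (retarget (end-ι j) (walk (ι j))) → v On walk (ι j)
      On-first⁻ j = proj₂ (retarget (end-ι j) (walk (ι j)))

      P-unique : ∀ i j → P j On walk (ι i) → j ≡ i
      P-unique i j = ι-injective ∘ disjoint (ι j) (ι i) (P j)
        (subst (_On walk (ι j)) (end-ι j) (On-end (walk (ι j))))

    -- Disjoint walks end at different targets, so `s` of them use up all `s` targets and can be
    -- renumbered by `ι` according to the target reached. As `P j` ends walk `ι j`, no other walk
    -- passes through it; cutting each walk at the first visit to its own target then keeps all
    -- targets off the earlier part.
    linkageTo : LinkageTo R A P
    linkageTo = record
      { walk     = λ j → proj₁ (first j)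
      ; start∈A  = start∈A ∘ ι
      ; disjoint = λ i j v on on′ → ι-injective (disjoint (ι i) (ι j) v
          (On-first⁻ i (proj₁ (proj₂ (first i)) v on)) (On-first⁻ j (proj₁ (proj₂ (first j)) v on′)))
      ; approach = λ i on →
          let w , p = proj₂ (proj₂ (first i)) on in
          w , λ j onw → let on′ , last = p (P j) onw
                            j≡i        = P-unique i j (On-first⁻ i on′) in
            trans (last (cong P j≡i)) (cong P (sym j≡i))
      }

  -- Menger's theorem by induction on the list of arcs

  Step : List (V × V) → Rel V 0ℓ
  Step D u v = (u , v) ∈ D

  module _ {x y : V} {D : List (V × V)} where

    firstUse : ∀ {a b} (w : Star (Step ((x , y) ∷ D)) a b) →
      (∃ λ (w′ : Star (Step D) a b) → ∀ u → u On w′ → u On w) ⊎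
      (∃ λ (w′ : Star (Step D) a x) → ∀ u → u On w′ → u On w)
    firstUse ε                = inj₁ (ε , λ _ on → on)
    firstUse (here refl ◅ w)  = inj₂ (ε , λ { _ refl → inj₁ refl })
    firstUse (there r ◅ w) with firstUse w
    ... | inj₁ (w′ , sub) = inj₁ (r ◅ w′ , λ { u (inj₁ eq) → inj₁ eq ; u (inj₂ on) → inj₂ (sub u on) })
    ... | inj₂ (w′ , sub) = inj₂ (r ◅ w′ , λ { u (inj₁ eq) → inj₁ eq ; u (inj₂ on) → inj₂ (sub u on) })

    lastUse : ∀ {a b} (w : Star (Step ((x , y) ∷ D)) a b) →
      (∃ λ (w′ : Star (Step D) a b) → ∀ u → u On w′ → u On w) ⊎
      (∃ λ (w′ : Star (Step D) y b) → ∀ u → u On w′ → u On w)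
    lastUse ε       = inj₁ (ε , λ _ on → on)
    lastUse (r ◅ w) with lastUse w
    lastUse (r ◅ w)         | inj₂ (w′ , sub) = inj₂ (w′ , λ u → inj₂ ∘ sub u)
    lastUse (here refl ◅ w) | inj₁ (w′ , sub) = inj₂ (w′ , λ u → inj₂ ∘ sub u)
    lastUse (there r ◅ w)   | inj₁ (w′ , sub) =
      inj₁ (r ◅ w′ , λ { u (inj₁ eq) → inj₁ eq ; u (inj₂ on) → inj₂ (sub u on) })

  LinkageOrSeparator : Rel V 0ℓ → Pred V 0ℓ → Pred V 0ℓ → ℕ → Set
  LinkageOrSeparator R A B s =
    Linkage R A B s ⊎ ∃₂ λ m (S : Fin m → V) → m < s × Separates R A B S

  -- Göring's proof, by induction on the arcs: S separates once the arc from x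
  -- to y is removed, and P and Q both separate before that.  If neither of the
  -- two sides can be separated by fewer vertices, their linkages meet in S only.
  module _ (x y : V) (D : List (V × V)) {A B : Pred V 0ℓ} {m} (S : Fin m → V)
           (separates : Separates (Step D) A B S) where

    private
      P Q : Fin (suc m) → V
      P = x ∷ᶠ S
      Q = y ∷ᶠ S

    separates-cons : Separates (Step ((x , y) ∷ D)) A B P
    separates-cons w a∈A b∈B with firstUse w
    ... | inj₁ (w′ , sub) = let j , on = separates w′ a∈A b∈B in suc j , sub _ on
    ... | inj₂ (w′ , sub) = zero , sub x (On-end w′)

    -- Every walk from `A` to `B` contains a walk over `D` from `A` to `P`: its part before the
    -- first use of the new arc ends at `x`, and a walk without that arc meets `S`. So a small
    -- separator of this side is already one of `A` from `B`; `separates-after` is the mirror image.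
    separates-before : ∀ {n} (T : Fin n → V) → Separates (Step D) A (Image P) T →
                       Separates (Step ((x , y) ∷ D)) A B T
    separates-before T sepT w a∈A b∈B with firstUse w
    ... | inj₂ (w′ , sub) = let j , on = sepT w′ a∈A (zero , refl) in j , sub _ on
    ... | inj₁ (w′ , sub) =
      let i , on   = separates w′ a∈A b∈B
          w″ , sub′ = prefix w′ on
          j , on′  = sepT w″ a∈A (suc i , refl)
      in j , sub _ (sub′ _ on′)

    separates-after : ∀ {n} (T : Fin n → V) → Separates (Step D) (Image Q) B T →
                      Separates (Step ((x , y) ∷ D)) A B T
    separates-after T sepT w a∈A b∈B with lastUse w
    ... | inj₂ (w′ , sub) = let j , on = sepT w′ (zero , refl) b∈B in j , sub _ on
    ... | inj₁ (w′ , sub) =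
      let i , on   = separates w′ a∈A b∈B
          w″ , sub′ = suffix w′ on
          j , on′  = sepT w″ (suc i , refl) b∈B
      in j , sub _ (sub′ _ on′)

    -- `P` and `Q` differ only in their first entries, which the new arc connects; at every other
    -- index the two walks meet in the same vertex of `S`.
    glue : LinkageTo (Step D) A P → LinkageTo (flip (Step D)) B Q →
           Linkage (Step ((x , y) ∷ D)) A B (suc m)
    glue F G = record
      { walk     = walk
      ; start∈A  = F.start∈A
      ; end∈B    = G.start∈A
      ; disjoint = λ i j v on on′ → disjoint i j v (On-walk i on) (On-walk j on′)
      }
      where
      module F = LinkageTo F
      module G = LinkageTo G

      walk : ∀ i → Star (Step ((x , y) ∷ D)) (F.start i) (G.start i)
      walk zero    = Star.map there (F.walk zero) ◅◅
                     here refl ◅ Star.map there (Star.reverse id (G.walk zero))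
      walk (suc i) = Star.map there (F.walk (suc i)) ◅◅
                     Star.map there (Star.reverse id (G.walk (suc i)))

      On-G : ∀ i {v} → v On Star.map {U = Step ((x , y) ∷ D)} there (Star.reverse id (G.walk i)) → v On G.walk i
      On-G i on = On-reverse⁻ id (G.walk i) (On-map⁻ there (Star.reverse id (G.walk i)) on)

      On-walk : ∀ i {v} → v On walk i → v On F.walk i ⊎ v On G.walk i
      On-walk zero on with On-◅◅⁻ (Star.map there (F.walk zero)) on
      ... | inj₁ on₁         = inj₁ (On-map⁻ there (F.walk zero) on₁)
      ... | inj₂ (inj₁ refl) = inj₁ (On-end (F.walk zero))
      ... | inj₂ (inj₂ on₂)  = inj₂ (On-G zero on₂)
      On-walk (suc i) on = [ inj₁ ∘ On-map⁻ there (F.walk (suc i)) , inj₂ ∘ On-G (suc i) ]′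
        (On-◅◅⁻ (Star.map there (F.walk (suc i))) on)

      -- The two approaches to `v` form a walk over `D` from `A` to `B`, which must meet `S`.
      -- Neither approach touches its targets before `v`, so `v` itself lies in `S` and ends one
      -- walk of each linkage.
      cross : ∀ i j v → v On F.walk i → v On G.walk j → i ≡ j
      cross i j v on on′ =
        let w , only    = F.approach i on
            w′ , only′  = G.approach j on′
            l , onl     = separates (w ◅◅ Star.reverse id w′) (F.start∈A i) (G.start∈A j)
            v≡Sl        = [ only (suc l) , only′ (suc l) ∘ On-reverse⁻ id w′ ]′ (On-◅◅⁻ w onl)
        in trans (F.disjoint i (suc l) v on (subst (_On F.walk (suc l)) (sym v≡Sl) (On-end (F.walk (suc l)))))
                 (G.disjoint (suc l) j v (subst (_On G.walk (suc l)) (sym v≡Sl) (On-end (G.walk (suc l)))) on′)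

      disjoint : ∀ i j v → v On F.walk i ⊎ v On G.walk i → v On F.walk j ⊎ v On G.walk j → i ≡ j
      disjoint i j v (inj₁ on) (inj₁ on′) = F.disjoint i j v on on′
      disjoint i j v (inj₁ on) (inj₂ on′) = cross i j v on on′
      disjoint i j v (inj₂ on) (inj₁ on′) = sym (cross j i v on′ on)
      disjoint i j v (inj₂ on) (inj₂ on′) = G.disjoint i j v on on′

  -- `A` and `B` vary because the induction step also uses `x ∷ᶠ S` as a target set and `y ∷ᶠ S` as
  -- a source set. Without arcs a walk is a single vertex, so the common vertices of `A` and `B`
  -- form both the largest linkage and a separator.
  menger-arcs : ∀ D {A B} → Decidable A → Decidable B → ∀ s → LinkageOrSeparator (Step D) A B s
  menger-arcs [] {A} {B} A? B? s with s ≤? length (filter (λ v → A? v ×-dec B? v) (allFin N))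
  ... | yes s≤ = inj₁ record
    { walk     = λ i → ε
    ; start∈A  = λ i → proj₁ (A∩B i)
    ; end∈B    = λ i → proj₂ (A∩B i)
    ; disjoint = λ i j v on on′ → inject≤-injective s≤ s≤ i j
        (lookup-injective (Unique-filter⁺ AB? (allFin⁺ N)) (trans (sym on) on′))
    }
    where
    AB? = λ v → A? v ×-dec B? v
    A∩B : ∀ i → _
    A∩B i = proj₂ (∈-filter⁻ AB? {xs = allFin N} (∈-lookup (inject≤ i s≤)))
  ... | no s≰ = inj₂ (_ , lookup xs , ≰⇒> s≰ , sep)
    where
    AB? = λ v → A? v ×-dec B? v
    xs = filter AB? (allFin N)
    sep : Separates (Step []) A B (lookup xs)
    sep ε a∈A a∈B = let i = ∈-filter⁺ AB? (∈-allFin _) (a∈A , a∈B) in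
      Any.index i , sym (lookup-index i)
  menger-arcs ((x , y) ∷ D) A? B? s with menger-arcs D A? B? s
  ... | inj₁ L = inj₁ (mapLinkage there L)
  ... | inj₂ (m , S , m<s , sep) with suc m <? s
  ...   | yes 1+m<s = inj₂ (suc m , x ∷ᶠ S , 1+m<s , separates-cons x y D S sep)
  -- Here `s` is `suc m`, the number of entries of `x ∷ᶠ S` and `y ∷ᶠ S`, so a linkage of size `s`
  -- into either uses all of them.
  ...   | no ¬1+m<s with ≤-antisym m<s (≮⇒≥ ¬1+m<s)
  ...     | refl with menger-arcs D A? (image? (x ∷ᶠ S)) (suc m)
                    | menger-arcs D (image? (y ∷ᶠ S)) B? (suc m)
  ...       | inj₂ (n , T , n<s , sepT) | _ = inj₂ (n , T , n<s , separates-before x y D S sep T sepT)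
  ...       | inj₁ _ | inj₂ (n , T , n<s , sepT) = inj₂ (n , T , n<s , separates-after x y D S sep T sepT)
  ...       | inj₁ L | inj₁ L′ = inj₁ (glue x y D S sep (linkageTo L) (linkageTo (reverseLinkage L′)))

  module _ {R : Rel V 0ℓ} (R? : B.Decidable R) where

    private
      arcs : List (V × V)
      arcs = filter (λ (u , v) → R? u v) (cartesianProduct (allFin N) (allFin N))

      arcs⁻ : Step arcs ⇒ R
      arcs⁻ = proj₂ ∘ ∈-filter⁻ (λ (u , v) → R? u v) {xs = cartesianProduct (allFin N) (allFin N)}

      arcs⁺ : R ⇒ Step arcs
      arcs⁺ r = ∈-filter⁺ (λ (u , v) → R? u v) (∈-cartesianProduct⁺ (∈-allFin _) (∈-allFin _)) r

    menger : ∀ {A B} → Decidable A → Decidable B → ∀ s → LinkageOrSeparator R A B s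
    menger A? B? s with menger-arcs arcs A? B? s
    ... | inj₁ L                   = inj₁ (mapLinkage arcs⁻ L)
    ... | inj₂ (m , S , m<s , sep) = inj₂ (m , S , m<s , λ w a∈A b∈B →
      let j , on = sep (Star.map arcs⁺ w) a∈A b∈B in j , On-map⁻ arcs⁺ w on)

    abstract

      -- Menger's theorem for s = 1: a separator with no vertices excludes every walk.
      reachable? : B.Decidable (Star R)
      reachable? a b with menger (_≟ a) (_≟ b) 1
      ... | inj₁ L = yes (subst (λ c → Star R c b) (start∈A zero) (subst (Star R _) (end∈B zero) (walk zero)))
        where open Linkage L
      ... | inj₂ (zero , S , _ , sep) = no λ w → contradiction (proj₁ (sep w refl refl)) λ ()
      ... | inj₂ (suc m , S , s≤s () , sep)

-- Spans over ℤ₂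

anyVec? : ∀ {n} {P : Pred (Vec Parity n) 0ℓ} → Decidable P → Dec (∃ P)
anyVec? {zero}  P? = map′ (λ p → [] , p) (λ { ([] , p) → p }) (P? [])
anyVec? {suc n} P? = map′
  [ (λ { (v , p) → 0ℙ ∷ v , p }) , (λ { (v , p) → 1ℙ ∷ v , p }) ]′
  (λ { (0ℙ ∷ v , p) → inj₁ (v , p) ; (1ℙ ∷ v , p) → inj₂ (v , p) })
  (anyVec? (P? ∘ (0ℙ ∷_)) ⊎-dec anyVec? (P? ∘ (1ℙ ∷_)))

allVec? : ∀ {n} {P : Pred (Vec Parity n) 0ℓ} → Decidable P → Dec (∀ v → P v)
allVec? P? = map′ (λ ∄ v → decidable-stable (P? v) (λ ¬p → ∄ (v , ¬p)))
                  (λ p (v , ¬p) → ¬p (p v)) (¬? (anyVec? (¬? ∘ P?)))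

module Linear (M : Module ℤ₂ 0ℓ 0ℓ) where

  open Module M
  open LinearAlgebra M
  open Sum +ᴹ-commutativeMonoid using (sum-cong-≋; sum-replicate-zero)
  open IsSubspace

  linComb-0 : ∀ {n} (v : Vector Carrierᴹ n) → linComb (λ _ → 0ℙ) v ≈ᴹ 0ᴹ
  linComb-0 {n} v = ≈ᴹ-trans (sum-cong-≋ (*ₗ-zeroˡ ∘ v)) (sum-replicate-zero n)

  ∈⇒Span : ∀ xs {x} → x ∈ xs → Span xs x
  ∈⇒Span (x ∷ xs) (here refl)  = 1ℙ ∷ᶠ (λ _ → 0ℙ) ,
    ≈ᴹ-trans (+ᴹ-cong (*ₗ-identityˡ x) (linComb-0 (lookup xs))) (+ᴹ-identityʳ x)
  ∈⇒Span (x ∷ xs) (there x∈xs) = let c , p = ∈⇒Span xs x∈xs in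
    0ℙ ∷ᶠ c , ≈ᴹ-trans (+ᴹ-cong (*ₗ-zeroˡ x) p) (+ᴹ-identityˡ _)

  Span-least : ∀ {K} → IsSubspace K → ∀ xs → (∀ {x} → x ∈ xs → K x) → Span xs ⊆′ K
  Span-least isSubspace []       xs⊆K y (c , p) = resp-≈ isSubspace p (0ᴹ-closed isSubspace)
  Span-least isSubspace (x ∷ xs) xs⊆K y (c , p) = resp-≈ isSubspace p (+ᴹ-closed isSubspace
    (*ₗ-closed isSubspace (c zero) (xs⊆K (here refl)))
    (Span-least isSubspace xs (xs⊆K ∘ there) _ (c ∘ suc , ≈ᴹ-refl)))

  +-cancel : ∀ x y → (x +ᴹ -ᴹ y) +ᴹ y ≈ᴹ x
  +-cancel x y = ≈ᴹ-trans (+ᴹ-assoc x (-ᴹ y) y)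
    (≈ᴹ-trans (+ᴹ-cong ≈ᴹ-refl (-ᴹ‿inverseˡ y)) (+ᴹ-identityʳ x))

  +-self : ∀ x → x +ᴹ x ≈ᴹ 0ᴹ
  +-self x = ≈ᴹ-trans (+ᴹ-cong (≈ᴹ-sym (*ₗ-identityˡ x)) (≈ᴹ-sym (*ₗ-identityˡ x)))
    (≈ᴹ-trans (≈ᴹ-sym (*ₗ-distribʳ x 1ℙ 1ℙ)) (*ₗ-zeroˡ x))

  module _ {K} (isSubspace : IsSubspace K) {z} (z∈K : K z) where

    open Setoid (quotient (Span-isSubspace [ z ])) using () renaming (_≈_ to _≈ᶻ_; sym to mod-sym)

    resp-mod : ∀ {x y} → x ≈ᶻ y → K y → K x
    resp-mod {x} {y} x≈y y∈K = resp-≈ isSubspace (+-cancel x y) (+ᴹ-closed isSubspace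
      (Span-least isSubspace [ z ] (λ { (here refl) → z∈K }) _ x≈y) y∈K)

    -- Adding a multiple of `z ∈ K` does not change membership in `K`, so an equality of multisets
    -- modulo `z` restricts to the members of `K`. This makes the edges with colours in a subspace
    -- inherit the congruence condition.
    filter-mod : (K? : Decidable K) → ∀ {xs ys} → xs ≡ ys mod⟨ z ⟩ → filter K? xs ≡ filter K? ys mod⟨ z ⟩
    filter-mod K? = filter⁺ K? (resp-mod ∘ mod-sym)
      where open PermutationProperties (quotient (Span-isSubspace [ z ])) using (filter⁺)

  -- Congruence modulo `z` compares the spans only in the quotient; `z` in the span of `ys` lifts
  -- the comparison. In the application `z` is the colour of an edge, which occurs among the colours
  -- at both of its ends.
  Span-mod : ∀ xs ys {z} → xs ≡ ys mod⟨ z ⟩ → Span ys z → Span xs ⊆′ Span ys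
  Span-mod xs ys {z} xs↭ys z∈ = Span-least (Span-isSubspace ys) xs λ x∈xs →
    let y , y∈ys , x≈y = find (∈-resp-↭ xs↭ys (Any.map (λ { refl → mod-refl }) x∈xs)) in
    resp-mod (Span-isSubspace ys) z∈ x≈y (∈⇒Span ys y∈ys)
    where
    open PermutationProperties (quotient (Span-isSubspace [ z ])) using (∈-resp-↭)
    open Setoid (quotient (Span-isSubspace [ z ])) using () renaming (refl to mod-refl)

  -- In characteristic 2, moving `v zero` to the other side gives a relation in which its
  -- coefficient is 1. Padding with zeros fits the relation to independence of more than three
  -- vectors.
  dependence : ∀ {m} (v : Vector Carrierᴹ (3 + m)) → Span (v (suc zero) ∷ v (suc (suc zero)) ∷ []) (v zero) →
               ∃ λ c → linComb c v ≈ᴹ 0ᴹ × c zero ≡ 1ℙ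
  dependence v (c , p) = 1ℙ ∷ᶠ c zero ∷ᶠ c (suc zero) ∷ᶠ (λ _ → 0ℙ) ,
    ≈ᴹ-trans (+ᴹ-cong (*ₗ-identityˡ (v zero))
      (≈ᴹ-trans (+ᴹ-cong ≈ᴹ-refl (+ᴹ-cong ≈ᴹ-refl (linComb-0 (λ i → v (suc (suc (suc i))))))) p))
    (+-self (v zero)) , refl

  abstract

    Span? : B.Decidable _≈ᴹ_ → ∀ xs → Decidable (Span xs)
    Span? _≈?_ xs x = map′ (λ { (c , p) → Vec.lookup c , p })
      (λ { (c , p) → Vec.tabulate c , ≈ᴹ-trans
        (sum-cong-≋ (λ i → *ₗ-cong (lookup∘tabulate c i) ≈ᴹ-refl)) p })
      (anyVec? λ c → linComb (Vec.lookup c) (lookup xs) ≈? x)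

abstract

  -- Equality of characters is tested on all vectors of parities; `⟦⟧-cong` carries the result over
  -- to functions, which agree with their tabulations only pointwise.
  _≟ᶜ_ : ∀ {k} → B.Decidable (Module._≈ᴹ_ (Hom k))
  ρ ≟ᶜ σ = map′
    (λ p g → trans (⟦⟧-cong ρ (λ i → sym (lookup∘tabulate g i)))
               (trans (p (Vec.tabulate g)) (⟦⟧-cong σ (lookup∘tabulate g))))
    (λ p v → p (Vec.lookup v))
    (allVec? λ v → ⟦ ρ ⟧ (Vec.lookup v) ℙ.≟ ⟦ σ ⟧ (Vec.lookup v))
    where open Character

-- Decidable subsets and counting modulo 2

module _ {n} {P : Pred (Fin n) 0ℓ} (P? : Decidable P) where

  subset : Subset n
  subset = Vec.tabulate (does ∘ P?)

  ∈-subset⁺ : ∀ {i} → P i → i ∈ˢ subset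
  ∈-subset⁺ {i} p = lookup⇒[]= i subset (trans (lookup∘tabulate (does ∘ P?) i) (dec-true (P? i) p))

  ∈-subset⁻ : ∀ {i} → i ∈ˢ subset → P i
  ∈-subset⁻ {i} i∈ with P? i | trans (sym (lookup∘tabulate (does ∘ P?) i)) ([]=⇒lookup i∈)
  ... | yes p | _ = p

open Sum ℤ₂.+-commutativeMonoid using (sum; sum-cong-≗; sum-replicate-zero; ∑-distrib-+; ∑-comm)

indicator : ∀ {P : Set} → Dec P → Parity
indicator P? = if does P? then 1ℙ else 0ℙ

sum-zero : ∀ {n} {f : Fin n → Parity} → (∀ i → f i ≡ 0ℙ) → sum f ≡ 0ℙ
sum-zero {n} f≡0 = trans (sum-cong-≗ f≡0) (sum-replicate-zero n)

sum-indicator : ∀ {n} (j : Fin n) (f : Fin n → Parity) → sum (λ i → indicator (j ≟ i) ⊗ f i) ≡ f j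
sum-indicator {suc n} zero    f = trans (cong (f zero ⊕_) (sum-replicate-zero n)) (ℙ.+-identityʳ (f zero))
sum-indicator {suc n} (suc j) f = sum-indicator j (f ∘ suc)

sum-only : ∀ {n} (j : Fin n) {f : Fin n → Parity} → (∀ i → i ≢ j → f i ≡ 0ℙ) → sum f ≡ f j
sum-only j {f} f≡0 = trans (sum-cong-≗ pointwise) (sum-indicator j f)
  where
  pointwise : ∀ i → f i ≡ indicator (j ≟ i) ⊗ f i
  pointwise i with j ≟ i
  ... | yes _  = refl
  ... | no j≢i = f≡0 i (j≢i ∘ sym)

-- Degrees are lengths of filtered lists; as sums over all edges their parities allow an exchange of
-- the order of summation.
parity-filter : ∀ {n} {A : Set} {P : Pred A 0ℓ} (P? : Decidable P) (f : Fin n → A) →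
                parity (length (filter P? (tabulate f))) ≡ sum (λ i → indicator (P? (f i)))
parity-filter {zero}  P? f = refl
parity-filter {suc n} P? f with P? (f zero)
... | yes _ = trans (ℙ.+-homo-+ 1 (length (filter P? (tabulate (f ∘ suc)))))
                    (cong (1ℙ ⊕_) (parity-filter P? (f ∘ suc)))
... | no _  = parity-filter P? (f ∘ suc)

-- Multigraphs

module GraphProperties (G : Graph) where

  open Graph G
  open Subgraph

  joins? : ∀ e p q → Dec (Joins e p q)
  joins? e p q = ((src e ≟ p) ×-dec (tgt e ≟ q)) ⊎-dec ((src e ≟ q) ×-dec (tgt e ≟ p))

  Joins-sym : ∀ {e p q} → Joins e p q → Joins e q p
  Joins-sym = swap

  Joins⇒≢ : ∀ {e p q} → Joins e p q → p ≢ q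
  Joins⇒≢ {e} (inj₁ (refl , refl)) eq = loopless e eq
  Joins⇒≢ {e} (inj₂ (refl , refl)) eq = loopless e (sym eq)

  Joins⇒Incidentˡ : ∀ {e p q} → Joins e p q → Incident p e
  Joins⇒Incidentˡ (inj₁ (s , t)) = inj₁ s
  Joins⇒Incidentˡ (inj₂ (s , t)) = inj₂ t

  Joins⇒Incidentʳ : ∀ {e p q} → Joins e p q → Incident q e
  Joins⇒Incidentʳ = Joins⇒Incidentˡ ∘ Joins-sym

  Joins-unique : ∀ {e p q r} → Joins e p q → Joins e p r → q ≡ r
  Joins-unique     (inj₁ (_ , t)) (inj₁ (_ , t′)) = trans (sym t) t′
  Joins-unique {e} (inj₁ (s , _)) (inj₂ (_ , t′)) = contradiction (trans s (sym t′)) (loopless e)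
  Joins-unique {e} (inj₂ (_ , t)) (inj₁ (s′ , _)) = contradiction (trans s′ (sym t)) (loopless e)
  Joins-unique     (inj₂ (s , _)) (inj₂ (s′ , _)) = trans (sym s) s′

  Incident⇒ends : ∀ {e p q v} → Joins e p q → Incident v e → v ≡ p ⊎ v ≡ q
  Incident⇒ends (inj₁ (refl , refl)) (inj₁ refl) = inj₁ refl
  Incident⇒ends (inj₁ (refl , refl)) (inj₂ refl) = inj₂ refl
  Incident⇒ends (inj₂ (refl , refl)) (inj₁ refl) = inj₂ refl
  Incident⇒ends (inj₂ (refl , refl)) (inj₂ refl) = inj₁ refl

  opposite : ∀ {p e} → Incident p e → ∃ (Joins e p)
  opposite {e = e} (inj₁ s) = tgt e , inj₁ (s , refl)
  opposite {e = e} (inj₂ t) = src e , inj₂ (refl , t)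

  ends∈ : ∀ H {e p q} → e ∈ˢ edges H → Joins e p q → p ∈ˢ vertices H × q ∈ˢ vertices H
  ends∈ H e∈H (inj₁ (refl , refl)) = closed H e∈H
  ends∈ H e∈H (inj₂ (refl , refl)) = let s , t = closed H e∈H in t , s

  ∈-edgesAt⁺ : ∀ H {p e} → Incident p e → e ∈ˢ edges H → e ∈ edgesAt H p
  ∈-edgesAt⁺ H i e∈H = ∈-filter⁺ (λ e → incident? _ e ×-dec (e ∈ˢ? edges H)) (∈-allFin _) (i , e∈H)

  ∈-edgesAt⁻ : ∀ H {p e} → e ∈ edgesAt H p → Incident p e × e ∈ˢ edges H
  ∈-edgesAt⁻ H = proj₂ ∘ ∈-filter⁻ (λ e → incident? _ e ×-dec (e ∈ˢ? edges H)) {xs = allFin #E}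

  Unique-edgesAt : ∀ H p → Unique (edgesAt H p)
  Unique-edgesAt H p = Unique-filter⁺ (λ e → incident? p e ×-dec (e ∈ˢ? edges H)) (allFin⁺ #E)

  start∈ : ∀ {H p q} (w : Walk H p q) → p ∈ walkVertices w
  start∈ (nil _)        = here refl
  start∈ (cons _ _ _ _) = here refl

  edge-ends∈ : ∀ {H p q} (w : Walk H p q) {e v} → e ∈ walkEdges w → Incident v e → v ∈ walkVertices w
  edge-ends∈ (cons e _ j w) (here refl) i =
    [ (λ { refl → here refl }) , (λ { refl → there (start∈ w) }) ]′ (Incident⇒ends j i)
  edge-ends∈ (cons e _ j w) (there e∈)  i = there (edge-ends∈ w e∈ i)

  _⊑_ : ∀ {H p q r s} → Path H p q → Walk H r s → Set
  P ⊑ w = (∀ v → v ∈ Path.pathVertices P → v ∈ walkVertices w)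
        × (∀ e → e ∈ Path.pathEdges P → e ∈ walkEdges w)

  pathFrom : ∀ {H p q v} (P : Path H p q) → v ∈ Path.pathVertices P → ∃ λ (Q : Path H v q) → Q ⊑ Path.walk P
  pathFrom record { walk = w ; distinct = u } v∈ = from w u v∈
    where
    from : ∀ {H p q v} (w : Walk H p q) → Unique (walkVertices w) → v ∈ walkVertices w →
           ∃ λ (Q : Path H v q) → Q ⊑ w
    from w@(nil _)        u       (here refl) = record { walk = w ; distinct = u } , (λ _ → id) , (λ _ → id)
    from w@(cons _ _ _ _) u       (here refl) = record { walk = w ; distinct = u } , (λ _ → id) , (λ _ → id)
    from (cons _ _ _ w)   (_ ∷ u) (there v∈)  = let Q , vs , es = from w u v∈ in
      Q , (λ v → there ∘ vs v) , (λ e → there ∘ es e)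

  eraseLoops : ∀ {H p q} (w : Walk H p q) → ∃ λ (P : Path H p q) → P ⊑ w
  eraseLoops (nil p∈) = record { walk = nil p∈ ; distinct = [] ∷ [] } , (λ _ → id) , (λ _ → id)
  eraseLoops {p = p} (cons e e∈H j w) with eraseLoops w
  ... | P , vs , es with DecMembership._∈?_ _≟_ p (Path.pathVertices P)
  ...   | yes p∈ = let Q , vs′ , es′ = pathFrom P p∈ in
          Q , (λ v → there ∘ vs v ∘ vs′ v) , (λ e → there ∘ es e ∘ es′ e)
  ...   | no p∉ = record { walk = cons e e∈H j (Path.walk P) ; distinct = ¬Any⇒All¬ _ p∉ ∷ Path.distinct P }
          , (λ { v (here eq) → here eq ; v (there v∈) → there (vs v v∈) })
          , (λ { e (here eq) → here eq ; e (there e∈) → there (es e e∈) })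

  Adjacent : Subgraph → Rel V 0ℓ
  Adjacent H p q = ∃ λ e → e ∈ˢ edges H × Joins e p q

  adjacent? : ∀ H → B.Decidable (Adjacent H)
  adjacent? H p q = any? λ e → (e ∈ˢ? edges H) ×-dec joins? e p q

  Adjacent-sym : ∀ H {p q} → Adjacent H p q → Adjacent H q p
  Adjacent-sym H (e , e∈H , j) = e , e∈H , Joins-sym j

  Adjacent⇒whole : ∀ H → Adjacent H ⇒ Adjacent whole
  Adjacent⇒whole H (e , _ , j) = e , ∈⊤ , j

  toWalk : ∀ {H p q} → p ∈ˢ vertices H → (w : Star (Adjacent H) p q) →
           ∃ λ (w′ : Walk H p q) → ∀ v → v ∈ walkVertices w′ → v On w
  toWalk p∈H ε = nil p∈H , λ { _ (here refl) → refl }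
  toWalk {H} p∈H ((e , e∈H , j) ◅ w) = let w′ , sub = toWalk (proj₂ (ends∈ H e∈H j)) w in
    cons e e∈H j w′ , λ { v (here eq) → inj₁ eq ; v (there v∈) → inj₂ (sub v v∈) }

  fromWalk : ∀ {H p q} → Walk H p q → Star (Adjacent H) p q
  fromWalk (nil _)          = ε
  fromWalk (cons e e∈H j w) = (e , e∈H , j) ◅ fromWalk w

  -- Double counting, modulo 2, of the incidences between the edges of H and
  -- the vertices in C.
  even-boundary : ∀ H {C : Pred V 0ℓ} (C? : Decidable C) →
    (∀ {v} → C v → parity (length (edgesAt H v)) ≡ 0ℙ) →
    sum (λ e → indicator (e ∈ˢ? edges H) ⊗ (indicator (C? (src e)) ⊕ indicator (C? (tgt e)))) ≡ 0ℙ
  even-boundary H C? even = begin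
    sum (λ e → indicator (e ∈ˢ? edges H) ⊗ (indicator (C? (src e)) ⊕ indicator (C? (tgt e)))) ≡⟨ sum-cong-≗ column ⟨
    sum (λ e → sum (λ v → incidence v e))                                                     ≡⟨ ∑-comm (flip incidence) ⟩
    sum (λ v → sum (incidence v))                                                             ≡⟨ sum-zero row ⟩
    0ℙ ∎
    where
    open ≡-Reasoning

    incidence : V → E → Parity
    incidence v e = indicator (C? v ×-dec (incident? v e ×-dec (e ∈ˢ? edges H)))

    row : ∀ v → sum (incidence v) ≡ 0ℙ
    row v with C? v
    ... | no _  = sum-replicate-zero #E
    ... | yes c = trans (sym (parity-filter (λ e → incident? v e ×-dec (e ∈ˢ? edges H)) id)) (even c)

    column : ∀ e → sum (λ v → incidence v e) ≡
                   indicator (e ∈ˢ? edges H) ⊗ (indicator (C? (src e)) ⊕ indicator (C? (tgt e)))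
    column e with e ∈ˢ? edges H
    ... | no e∉H = sum-zero no-incidence
      where
      no-incidence : ∀ v → indicator (C? v ×-dec (incident? v e ×-dec no e∉H)) ≡ 0ℙ
      no-incidence v with does (C? v) | does (incident? v e)
      ... | true  | true  = refl
      ... | true  | false = refl
      ... | false | _     = refl
    ... | yes e∈H = begin
      _ ≡⟨ sum-cong-≗ split ⟩
      sum (λ v → (indicator (src e ≟ v) ⊗ indicator (C? v)) ⊕ (indicator (tgt e ≟ v) ⊗ indicator (C? v)))
        ≡⟨ ∑-distrib-+ (λ v → indicator (src e ≟ v) ⊗ indicator (C? v))
                       (λ v → indicator (tgt e ≟ v) ⊗ indicator (C? v)) ⟩
      sum (λ v → indicator (src e ≟ v) ⊗ indicator (C? v)) ⊕ sum (λ v → indicator (tgt e ≟ v) ⊗ indicator (C? v))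
        ≡⟨ cong₂ _⊕_ (sum-indicator (src e) (indicator ∘ C?)) (sum-indicator (tgt e) (indicator ∘ C?)) ⟩
      indicator (C? (src e)) ⊕ indicator (C? (tgt e)) ∎
      where
      split : ∀ v → indicator (C? v ×-dec (incident? v e ×-dec yes e∈H)) ≡
                    (indicator (src e ≟ v) ⊗ indicator (C? v)) ⊕ (indicator (tgt e ≟ v) ⊗ indicator (C? v))
      split v with src e ≟ v | tgt e ≟ v | C? v
      ... | yes s | yes t | _     = contradiction (trans s (sym t)) (loopless e)
      ... | yes _ | no _  | yes _ = refl
      ... | yes _ | no _  | no _  = refl
      ... | no _  | yes _ | yes _ = refl
      ... | no _  | yes _ | no _  = refl
      ... | no _  | no _  | yes _ = refl
      ... | no _  | no _  | no _  = refl

  -- An edge of `H` counts in the even sum exactly when one end lies in `C` and the other does not.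
  -- The last condition would leave `x` as the only such edge, so the sum would be 1.
  no-odd-boundary : ∀ H {C : Pred V 0ℓ} (C? : Decidable C) →
    (∀ {v} → C v → parity (length (edgesAt H v)) ≡ 0ℙ) →
    ∀ {x q a} → x ∈ˢ edges H → Joins x q a → ¬ C q → C a →
    ¬ (∀ {e u v} → e ∈ˢ edges H → e ≢ x → Joins e u v → C u → C v)
  no-odd-boundary H {C} C? even {x} {q} {a} x∈H j ¬cq ca transfer =
    contradiction (trans (sym (even-boundary H C? even)) (trans (sum-only x balanced) (unbalanced j))) λ ()
    where
    boundary : E → Parity
    boundary e = indicator (e ∈ˢ? edges H) ⊗ (indicator (C? (src e)) ⊕ indicator (C? (tgt e)))

    balanced : ∀ e → e ≢ x → boundary e ≡ 0ℙ
    balanced e e≢x with e ∈ˢ? edges H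
    ... | no _    = refl
    ... | yes e∈H with C? (src e) | C? (tgt e)
    ...   | yes _ | yes _ = refl
    ...   | no _  | no _  = refl
    ...   | yes s | no ¬t = contradiction (transfer e∈H e≢x (inj₁ (refl , refl)) s) ¬t
    ...   | no ¬s | yes t = contradiction (transfer e∈H e≢x (inj₂ (refl , refl)) t) ¬s

    unbalanced : Joins x q a → boundary x ≡ 1ℙ
    unbalanced j with x ∈ˢ? edges H
    ... | no x∉H = contradiction x∈H x∉H
    ... | yes _ with C? (src x) | C? (tgt x) | j
    ...   | yes _ | no _  | _                  = refl
    ...   | no _  | yes _ | _                  = refl
    ...   | yes s | yes _ | inj₁ (refl , refl) = contradiction s ¬cq
    ...   | yes _ | yes t | inj₂ (refl , refl) = contradiction t ¬cq
    ...   | no _  | no ¬t | inj₁ (refl , refl) = contradiction ca ¬t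
    ...   | no ¬s | no _  | inj₂ (refl , refl) = contradiction ca ¬s

  module _ (H : Subgraph) (even : ∀ {v} → v ∈ˢ vertices H → parity (length (edgesAt H v)) ≡ 0ℙ)
           {q a b x y} (x∈H : x ∈ˢ edges H) (x≢y : x ≢ y) (jx : Joins x q a) (jy : Joins y q b)
           (only : ∀ {e} → e ∈ˢ edges H → Incident q e → e ≡ x ⊎ e ≡ y) where

    private
      R : Rel V 0ℓ
      R u v = Adjacent H u v × u ≢ q × v ≢ q

      R? : B.Decidable R
      R? u v = adjacent? H u v ×-dec (¬? (u ≟ q) ×-dec ¬? (v ≟ q))

      Reach : Pred V 0ℓ
      Reach = Star R a

      Reach? : Decidable Reach
      Reach? = reachable? R? a

      a≢q : a ≢ q
      a≢q = Joins⇒≢ jx ∘ sym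

      avoids : ∀ {u v} → u ≢ q → (w : Star R u v) → ¬ (q On w)
      avoids u≢q ε                     eq        = u≢q (sym eq)
      avoids u≢q ((_ , _ , v≢q) ◅ w) (inj₁ eq) = u≢q (sym eq)
      avoids u≢q ((_ , _ , v≢q) ◅ w) (inj₂ on) = avoids v≢q w on

      Reach⇒∈ : ∀ {u v} → u ∈ˢ vertices H → Star R u v → v ∈ˢ vertices H
      Reach⇒∈ u∈H ε                          = u∈H
      Reach⇒∈ u∈H (((_ , e∈H , j) , _) ◅ w) = Reach⇒∈ (proj₂ (ends∈ H e∈H j)) w

      module _ (¬ab : ¬ Star R a b) where

        extend : ∀ {e u v} → e ∈ˢ edges H → e ≢ x → Joins e u v → Reach u → Reach v
        extend {e} {u} {v} e∈H e≢x j ru with v ≟ q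
        ... | no v≢q = ru ◅◅ ((e , e∈H , j) , (λ { refl → avoids a≢q ru (On-end ru) }) , v≢q) ◅ ε
        -- Besides `x`, only `y` can lead into `q`, and then the step comes from `b`, which is
        -- assumed out of reach.
        ... | yes refl with only e∈H (Joins⇒Incidentʳ j)
        ...   | inj₁ e≡x  = contradiction e≡x e≢x
        ...   | inj₂ refl = contradiction (subst Reach (Joins-unique (Joins-sym j) jy) ru) ¬ab

        impossible : ⊥
        impossible = no-odd-boundary H Reach? (even ∘ Reach⇒∈ (proj₂ (ends∈ H x∈H jx))) x∈H jx
          (λ rq → avoids a≢q rq (On-end rq)) ε extend

    -- Otherwise x would be the only edge of H leaving the set of vertices that can
    -- be reached from a off q.
    walkAvoiding : ∃ λ (w : Star (Adjacent H) a b) → ¬ (q On w)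
    walkAvoiding with Reach? b
    ... | yes w  = Star.map proj₁ w , avoids a≢q w ∘ On-map⁻ proj₁ w
    ... | no ¬ab = ⊥-elim (impossible ¬ab)

-- Faces

filter-map : ∀ {A B : Set} {P : Pred B 0ℓ} (P? : Decidable P) (f : A → B) xs →
             filter P? (map f xs) ≡ map f (filter (P? ∘ f) xs)
filter-map P? f []       = refl
filter-map P? f (x ∷ xs) with P? (f x)
... | yes _ = cong (f x ∷_) (filter-map P? f xs)
... | no _  = filter-map P? f xs

filter-filter : ∀ {A : Set} {P Q : Pred A 0ℓ} (P? : Decidable P) (Q? : Decidable Q) xs →
                filter Q? (filter P? xs) ≡ filter (λ x → P? x ×-dec Q? x) xs
filter-filter P? Q? []       = refl
filter-filter P? Q? (x ∷ xs) with P? x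
... | no _  = filter-filter P? Q? xs
... | yes _ with Q? x
...   | yes _ = cong (x ∷_) (filter-filter P? Q? xs)
...   | no _  = filter-filter P? Q? xs

length-⊆ : ∀ {A : Set} {xs ys : List A} → Unique xs → (∀ {x} → x ∈ xs → x ∈ ys) → length xs ≤ length ys
length-⊆ {xs = xs} {ys} u xs⊆ys = injective⇒≤ {f = λ i → Any.index (xs⊆ys (∈-lookup i))} λ {i} {j} eq →
  lookup-injective u (trans (lookup-index (xs⊆ys (∈-lookup i)))
    (trans (cong (lookup ys) eq) (sym (lookup-index (xs⊆ys (∈-lookup j))))))

module _ {k n : ℕ} (S : Skeleton k n) where

  open Skeleton S
  open Subgraph
  open GraphProperties Γ
  open LinearAlgebra (Hom k)
  open Linear (Hom k)

  coloursAt : V → List (Character k)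
  coloursAt = colours Γ α whole

  module Component {K : Pred (Character k) 0ℓ} (isSubspace : IsSubspace K) (K? : Decidable K) (q : V) where

    private
      R : Rel V 0ℓ
      R u v = ∃ λ e → K (α e) × Joins e u v

      R? : B.Decidable R
      R? u v = any? λ e → K? (α e) ×-dec joins? e u v

      R-sym : ∀ {u v} → R u v → R v u
      R-sym (e , αe∈K , j) = e , αe∈K , Joins-sym j

      Reach? : Decidable (Star R q)
      Reach? = reachable? R? q

    -- The component of `q` in the graph of edges with colours in `K`. Testing only the source of an
    -- edge suffices, since such an edge makes both ends reachable as soon as one is.
    component : Subgraph
    component = record
      { vertices = subset Reach?
      ; edges    = subset (λ e → K? (α e) ×-dec Reach? (src e))
      ; closed   = λ {e} e∈ →
          let αe∈K , r = ∈-subset⁻ (λ e → K? (α e) ×-dec Reach? (src e)) e∈ in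
          ∈-subset⁺ Reach? r , ∈-subset⁺ Reach? (r ◅◅ (e , αe∈K , inj₁ (refl , refl)) ◅ ε)
      }

    q∈component : q ∈ˢ vertices component
    q∈component = ∈-subset⁺ Reach? ε

    edge∈⁺ : ∀ {e v} → v ∈ˢ vertices component → Incident v e → K (α e) → e ∈ˢ edges component
    edge∈⁺ {e} {v} v∈ i αe∈K = ∈-subset⁺ (λ e → K? (α e) ×-dec Reach? (src e)) (αe∈K , to-src i)
      where
      r : Star R q v
      r = ∈-subset⁻ Reach? v∈
      to-src : Incident v e → Star R q (src e)
      to-src (inj₁ refl) = r
      to-src (inj₂ refl) = r ◅◅ (e , αe∈K , inj₂ (refl , refl)) ◅ ε

    edge∈⁻ : ∀ {e} → e ∈ˢ edges component → K (α e)
    edge∈⁻ = proj₁ ∘ ∈-subset⁻ (λ e → K? (α e) ×-dec Reach? (src e))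

    colours-component : ∀ {p} → p ∈ˢ vertices component →
                        colours Γ α component p ≡ filter K? (coloursAt p)
    colours-component {p} p∈ = sym (begin
      filter K? (coloursAt p)                   ≡⟨ filter-map K? α (edgesAt whole p) ⟩
      map α (filter (K? ∘ α) (edgesAt whole p)) ≡⟨ cong (map α) (filter-filter _ (K? ∘ α) (allFin #E)) ⟩
      _ ≡⟨ cong (map α) (filter-≐ _ _
             ( (λ { ((i , _) , αe∈K) → i , edge∈⁺ p∈ i αe∈K })
             , (λ { (i , e∈) → (i , ∈⊤) , edge∈⁻ e∈ })) (allFin #E)) ⟩
      colours Γ α component p                   ∎)
      where open ≡-Reasoning

    -- For α e ∈ K, congruence modulo α e preserves membership in K, so the number
    -- and the span of the K-coloured edges at a vertex are constant along walks.
    private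
      congruent-filter : ∀ {e} → K (α e) →
                         filter K? (coloursAt (src e)) ≡ filter K? (coloursAt (tgt e)) mod⟨ α e ⟩
      congruent-filter {e} αe∈K = filter-mod isSubspace αe∈K K? (congruent e ∈⊤)

      length-step : ∀ {u v} → R u v → length (filter K? (coloursAt u)) ≡ length (filter K? (coloursAt v))
      length-step (e , αe∈K , inj₁ (refl , refl)) = xs↭ys⇒|xs|≡|ys| (congruent-filter αe∈K)
        where open PermutationProperties (quotient (Span-isSubspace [ α e ]))
      length-step (e , αe∈K , inj₂ (refl , refl)) = sym (xs↭ys⇒|xs|≡|ys| (congruent-filter αe∈K))
        where open PermutationProperties (quotient (Span-isSubspace [ α e ]))

      ∈-filtered : ∀ {e p} → Incident p e → K (α e) → α e ∈ filter K? (coloursAt p)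
      ∈-filtered i = ∈-filter⁺ K? (∈-map⁺ α (∈-edgesAt⁺ whole i ∈⊤))

      span-step : ∀ {u v} → R u v → Span (filter K? (coloursAt u)) ⊆′ Span (filter K? (coloursAt v))
      span-step (e , αe∈K , inj₁ (refl , refl)) = Span-mod _ _ {α e}
        (congruent-filter αe∈K) (∈⇒Span _ (∈-filtered (inj₂ refl) αe∈K))
      span-step (e , αe∈K , inj₂ (refl , refl)) = Span-mod _ _ {α e}
        (↭-sym (congruent-filter αe∈K)) (∈⇒Span _ (∈-filtered (inj₁ refl) αe∈K))
        where open Permutation (quotient (Span-isSubspace [ α e ]))

      length-constant : ∀ {u v} → Star R u v → length (filter K? (coloursAt u)) ≡ length (filter K? (coloursAt v))
      length-constant ε       = refl
      length-constant (r ◅ w) = trans (length-step r) (length-constant w)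

      span-constant : ∀ {u v} → Star R u v → Span (filter K? (coloursAt u)) ⊆′ Span (filter K? (coloursAt v))
      span-constant ε       x = id
      span-constant (r ◅ w) x = span-constant w x ∘ span-step r x

      within : ∀ {u v} → u ∈ˢ vertices component → Star R u v → Star (Adjacent component) u v
      within u∈ ε                    = ε
      within u∈ ((e , αe∈K , j) ◅ w) = let e∈ = edge∈⁺ u∈ (Joins⇒Incidentˡ j) αe∈K in
        (e , e∈ , j) ◅ within (proj₂ (ends∈ component e∈ j)) w

    component-connected : Connected component
    component-connected = (q , q∈component) , λ u v u∈ v∈ →
      let w = Star.reverse R-sym (∈-subset⁻ Reach? u∈) ◅◅ ∈-subset⁻ Reach? v∈ in
      proj₁ (eraseLoops (proj₁ (toWalk u∈ (within u∈ w))))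

    -- Valence and spanning are tested at `q` alone, because both are constant along walks in the
    -- component.
    face : ∀ {d} → d ≤ n → length (filter K? (coloursAt q)) ≡ d →
           K ⊆′ Span (filter K? (coloursAt q)) → Face S d
    face d≤n length≡d K⊆Span = record
      { d≤n        = d≤n
      ; subgraph   = component
      ; connected  = component-connected
      ; valent     = λ p p∈ → trans (sym (length-map α (edgesAt component p)))
          (trans (cong length (colours-component p∈))
            (trans (sym (length-constant (∈-subset⁻ Reach? p∈))) length≡d))
      ; K          = K
      ; isSubspace = isSubspace
      ; spanning   = λ p p∈ x → subst (λ cs → SpanIsK cs x) (sym (colours-component p∈)) (mk⇔
          (span-constant (∈-subset⁻ Reach? p∈) x ∘ K⊆Span x)
          (Span-least isSubspace _ (λ c∈ → proj₂ (∈-filter⁻ K? {xs = coloursAt p} c∈)) x))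
      ; congruent  = λ e e∈ → let s∈ , t∈ = closed component e∈ in
          subst₂ (λ cs ds → cs ≡ ds mod⟨ α e ⟩) (sym (colours-component s∈)) (sym (colours-component t∈))
            (congruent-filter (edge∈⁻ e∈))
      }
      where
      SpanIsK : List (Character k) → Character k → Set
      SpanIsK cs x = K x ⇔ Span cs x

  -- The 2-face spanned by two edges at a vertex

  module TwoFaces {l : ℕ} (3+l≤k : 3 + l ≤ k) (independent : Independent S (3 + l)) where

    -- Independence is given for exactly `3 + l` edges, so `e`, `x`, `y` must be completed to that
    -- many. Placing them before the remaining edges at `p` and cutting the list to length `3 + l`
    -- does so.
    independent⇒∉Span : ∀ {p e x y} → Incident p e → Incident p x → Incident p y →
                        e ≢ x → e ≢ y → x ≢ y → ¬ Span (α x ∷ α y ∷ []) (α e)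
    independent⇒∉Span {p} {e} {x} {y} ie ix iy e≢x e≢y x≢y αe∈ =
      let c , dependent , c₀≡1 = dependence (α ∘ f) αe∈ in
      contradiction (trans (sym c₀≡1) (independent p f f-injective incident c dependent zero)) λ ()
      where
      other? : Decidable (λ z → z ≢ e × z ≢ x × z ≢ y)
      other? z = ¬? (z ≟ e) ×-dec (¬? (z ≟ x) ×-dec ¬? (z ≟ y))

      rest fan : List E
      rest = filter other? (edgesAt whole p)
      fan = e ∷ x ∷ y ∷ rest

      rest-other : ∀ {z} → z ∈ rest → z ≢ e × z ≢ x × z ≢ y
      rest-other = proj₂ ∘ ∈-filter⁻ other? {xs = edgesAt whole p}

      fan-unique : Unique fan
      fan-unique = (e≢x ∷ e≢y ∷ All.tabulate (λ z∈ eq → proj₁ (rest-other z∈) (sym eq)))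
                 ∷ (x≢y ∷ All.tabulate (λ z∈ eq → proj₁ (proj₂ (rest-other z∈)) (sym eq)))
                 ∷ All.tabulate (λ z∈ eq → proj₂ (proj₂ (rest-other z∈)) (sym eq))
                 ∷ Unique-filter⁺ other? (Unique-edgesAt whole p)

      edgesAt⊆fan : ∀ {z} → z ∈ edgesAt whole p → z ∈ fan
      edgesAt⊆fan {z} z∈ with z ≟ e | z ≟ x | z ≟ y
      ... | yes z≡e | _       | _       = here z≡e
      ... | no _    | yes z≡x | _       = there (here z≡x)
      ... | no _    | no _    | yes z≡y = there (there (here z≡y))
      ... | no z≢e  | no z≢x  | no z≢y  = there (there (there (∈-filter⁺ other? z∈ (z≢e , z≢x , z≢y))))

      -- The fan contains all `n` edges at `p`, and `3 + l ≤ k ≤ n`.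
      l≤fan : 3 + l ≤ length fan
      l≤fan = ≤-trans 3+l≤k (≤-trans k≤n (≤-trans (≤-reflexive (sym (regular p ∈⊤)))
        (length-⊆ (Unique-edgesAt whole p) edgesAt⊆fan)))

      f : Fin (3 + l) → E
      f i = lookup fan (inject≤ i l≤fan)

      f-injective : Injective _≡_ _≡_ f
      f-injective eq = inject≤-injective l≤fan l≤fan _ _ (lookup-injective fan-unique eq)

      fan-incident : ∀ {z} → z ∈ fan → Incident p z
      fan-incident (here refl)                 = ie
      fan-incident (there (here refl))         = ix
      fan-incident (there (there (here refl))) = iy
      fan-incident (there (there (there z∈)))  =
        proj₁ (∈-edgesAt⁻ whole (proj₁ (∈-filter⁻ other? {xs = edgesAt whole p} z∈)))

      incident : ∀ i → Incident p (f i)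
      incident i = fan-incident (∈-lookup (inject≤ i l≤fan))

    record Corner (apex : V) (x y : E) : Set where
      field
        ix  : Incident apex x
        iy  : Incident apex y
        x≢y : x ≢ y

      plane : List (Character k)
      plane = α x ∷ α y ∷ []

      open Component (Span-isSubspace plane) (Span? _≟ᶜ_ plane) apex public

      plane-edges : ∀ {e} → Incident apex e → Span plane (α e) → e ≡ x ⊎ e ≡ y
      plane-edges {e} ie αe∈ with e ≟ x | e ≟ y
      ... | yes e≡x | _       = inj₁ e≡x
      ... | no _    | yes e≡y = inj₂ e≡y
      ... | no e≢x  | no e≢y  = contradiction αe∈ (independent⇒∉Span ie ix iy e≢x e≢y x≢y)

      only : ∀ {e} → e ∈ˢ edges component → Incident apex e → e ≡ x ⊎ e ≡ y
      only e∈ ie = plane-edges ie (edge∈⁻ e∈)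

      x∈plane : Span plane (α x)
      x∈plane = ∈⇒Span plane (here refl)

      y∈plane : Span plane (α y)
      y∈plane = ∈⇒Span plane (there (here refl))

      x∈component : x ∈ˢ edges component
      x∈component = edge∈⁺ q∈component ix x∈plane

      -- By 3-independence only `x` and `y` among the edges at the apex have colours in the plane,
      -- which gives valence 2 there and hence everywhere.
      twoFace : Face S 2
      twoFace = face (≤-trans (s≤s (s≤s z≤n)) (≤-trans (m≤m+n 3 l) (≤-trans 3+l≤k k≤n))) length≡2
        (Span-least (Span-isSubspace (filter plane? (coloursAt apex))) plane λ
          { (here refl)         → ∈⇒Span _ (∈-filter⁺ plane? (∈-map⁺ α (∈-edgesAt⁺ whole ix ∈⊤)) x∈plane)
          ; (there (here refl)) → ∈⇒Span _ (∈-filter⁺ plane? (∈-map⁺ α (∈-edgesAt⁺ whole iy ∈⊤)) y∈plane) })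
        where
        plane? : Decidable (Span plane)
        plane? = Span? _≟ᶜ_ plane

        at-apex : List E
        at-apex = filter (plane? ∘ α) (edgesAt whole apex)

        at-apex⊆ : ∀ {e} → e ∈ at-apex → e ∈ x ∷ y ∷ []
        at-apex⊆ e∈ = let e∈′ , αe∈ = ∈-filter⁻ (plane? ∘ α) {xs = edgesAt whole apex} e∈ in
          [ here , there ∘ here ]′ (plane-edges (proj₁ (∈-edgesAt⁻ whole e∈′)) αe∈)

        ⊆at-apex : ∀ {e} → e ∈ x ∷ y ∷ [] → e ∈ at-apex
        ⊆at-apex (here refl)         = ∈-filter⁺ (plane? ∘ α) (∈-edgesAt⁺ whole ix ∈⊤) x∈plane
        ⊆at-apex (there (here refl)) = ∈-filter⁺ (plane? ∘ α) (∈-edgesAt⁺ whole iy ∈⊤) y∈plane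

        length≡2 : length (filter plane? (coloursAt apex)) ≡ 2
        length≡2 = trans (cong length (filter-map plane? α (edgesAt whole apex)))
          (trans (length-map α at-apex) (≤-antisym
            (length-⊆ (Unique-filter⁺ (plane? ∘ α) (Unique-edgesAt whole apex)) at-apex⊆)
            (length-⊆ ((x≢y ∷ []) ∷ [] ∷ []) ⊆at-apex)))

-- Disjoint paths

pair-only : ∀ {N} {xs : List (Fin N)} {g g′ e} → length xs ≡ 2 →
            g ∈ xs → g′ ∈ xs → g ≢ g′ → e ∈ xs → e ≡ g ⊎ e ≡ g′
pair-only {g = g} {g′} {e} length≡2 g∈ g′∈ g≢g′ e∈ with e ≟ g | e ≟ g′
... | yes e≡g | _        = inj₁ e≡g
... | no _    | yes e≡g′ = inj₂ e≡g′
... | no e≢g  | no e≢g′  = contradiction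
  (subst (3 ≤_) length≡2 (length-⊆ ((e≢g ∷ e≢g′ ∷ []) ∷ (g≢g′ ∷ []) ∷ [] ∷ [])
    λ { (here refl) → e∈ ; (there (here refl)) → g∈ ; (there (there (here refl))) → g′∈ }))
  λ { (s≤s (s≤s ())) }

module _ {N : ℕ} {R : Rel (Fin N) 0ℓ} where

  -- If every walk met `ts`, two of them would meet it in the same entry, as there are fewer entries
  -- than walks. Such a common vertex is `a` or `b`, and neither is in `ts`.
  someWalkAvoids : ∀ {n a b} (walk : Fin n → Star R a b) →
    (∀ i j → i ≢ j → ∀ t → t On walk i → t On walk j → t ≡ a ⊎ t ≡ b) →
    ∀ {ts} → length ts < n → a ∉ ts → b ∉ ts → ∃ λ i → ∀ t → t On walk i → t ∉ ts
  someWalkAvoids {n} walk disjoint {ts} ts<n a∉ b∉ with any? (λ i → ¬? (Any.any? (_On? walk i) ts))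
  ... | yes (i , clean) = i , λ t on t∈ → clean (Any.map (λ { refl → on }) t∈)
  ... | no none = let i , j , i<j , eq = pigeonhole ts<n (Any.index ∘ hit) in
    contradiction (disjoint i j (<⇒≢ i<j) _ (lookup-index (hit i))
                    (subst (λ h → lookup ts h On walk j) (sym eq) (lookup-index (hit j))))
      [ (λ { eq′ → a∉ (subst (_∈ ts) eq′ (∈-lookup (Any.index (hit i)))) })
      , (λ { eq′ → b∉ (subst (_∈ ts) eq′ (∈-lookup (Any.index (hit i)))) }) ]′
    where
    hit : ∀ i → Any (_On walk i) ts
    hit i = decidable-stable (Any.any? (_On? walk i) ts) (λ clean → none (i , clean))

  beforeEnd : ∀ {a b} → a ≢ b → (w : Star R a b) →
              ∃₂ λ c (w′ : Star R a c) → R c b × (∀ t → t On w′ → t On w × t ≢ b)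
  beforeEnd a≢b ε = contradiction refl a≢b
  beforeEnd {a} {b} a≢b (_◅_ {j = v} r w) with v ≟ b
  ... | yes refl = a , ε , r , λ { _ refl → inj₁ refl , a≢b }
  ... | no v≢b   = let c , w′ , r′ , sub = beforeEnd v≢b w in
    c , r ◅ w′ , r′ , λ { t (inj₁ refl) → inj₁ refl , a≢b
                        ; t (inj₂ on)   → inj₂ (proj₁ (sub t on)) , proj₂ (sub t on) }

  afterLast : ∀ a {b c} → a ≢ b → (w : Star R c b) → ¬ (a On w) ⊎
              ∃₂ λ d (w′ : Star R d b) → R a d × (∀ t → t On w′ → t On w × t ≢ a)
  afterLast a a≢b ε = inj₁ a≢b
  afterLast a {c = c} a≢b (r ◅ w) with afterLast a a≢b w
  ... | inj₂ (d , w′ , r′ , sub) = inj₂ (d , w′ , r′ , λ t on → inj₂ (proj₁ (sub t on)) , proj₂ (sub t on))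
  ... | inj₁ a∉w with a ≟ c
  ...   | yes refl = inj₂ (_ , w , r , λ t on → inj₂ on , λ { refl → a∉w on })
  ...   | no a≢c   = inj₁ [ a≢c , a∉w ]′

  -- Cut after the last visit to `a`, then before the first visit to `b`. Nonadjacency guarantees
  -- that the first cut does not already land on `b`.
  interior : ∀ {a b} → a ≢ b → ¬ R a b → (w : Star R a b) →
             ∃₂ λ c d → ∃ λ (w′ : Star R c d) → R a c × R d b × (∀ t → t On w′ → t On w × t ≢ a × t ≢ b)
  interior {a} {b} a≢b ¬ab w with afterLast a a≢b w
  ... | inj₁ a∉w = contradiction (On-start w) a∉w
  ... | inj₂ (c , w₁ , ac , sub) =
    let d , w₂ , db , sub′ = beforeEnd (λ c≡b → ¬ab (subst (R a) c≡b ac)) w₁ in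
    c , d , w₂ , ac , db , λ t on → let on₁ , t≢b = sub′ t on ; on₀ , t≢a = sub t on₁ in on₀ , t≢a , t≢b

-- How 2-faces meet, and the routes around a vertex

module Connectivity {k n l : ℕ} (S : Skeleton k n) (3+l≤k : 3 + l ≤ k) (independent : Independent S (3 + l))
  (connected : Graph.Connected (Skeleton.Γ S) (Graph.whole (Skeleton.Γ S)))
  (meets : (F F′ : Face S 2) →
           Graph.Connected (Skeleton.Γ S) (_∩ᶠ_ S F F′) ⊎ Graph.Empty (Skeleton.Γ S) (_∩ᶠ_ S F F′))
  where

  open Skeleton S
  open Subgraph
  open GraphProperties Γ
  open LinearAlgebra (Hom k)
  open Linear (Hom k)
  open TwoFaces S 3+l≤k independent

  OnFace : V → V → E → E → Set
  OnFace t q x y = ∃ λ (C : Corner q x y) → t ∈ˢ vertices (Corner.component C)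

  On-Adjacent⇒∈ : ∀ H {u v t} → u ∈ˢ vertices H → (w : Star (Adjacent H) u v) → t On w → t ∈ˢ vertices H
  On-Adjacent⇒∈ H u∈ ε refl = u∈
  On-Adjacent⇒∈ H u∈ (_ ◅ w) (inj₁ refl) = u∈
  On-Adjacent⇒∈ H u∈ ((e , e∈ , j) ◅ w) (inj₂ on) = On-Adjacent⇒∈ H (proj₂ (ends∈ H e∈ j)) w on

  WalkIn : Pred V 0ℓ → V → V → Set
  WalkIn P a b = ∃ λ (w : Star (Adjacent whole) a b) → ∀ t → t On w → P t

  relax : ∀ {P Q a b} → WalkIn P a b → (∀ {t} → P t → Q t) → WalkIn Q a b
  relax (w , p) f = w , λ t → f ∘ p t

  join : ∀ {P Q a b c} → WalkIn P a c → WalkIn Q b c → WalkIn (λ t → P t ⊎ Q t) a b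
  join (w , p) (w′ , q) = w ◅◅ Star.reverse (Adjacent-sym whole) w′ , λ t on →
    [ inj₁ ∘ p t , inj₂ ∘ q t ∘ On-reverse⁻ (Adjacent-sym whole) w′ ]′ (On-◅◅⁻ w on)

  abstract

    -- All degrees in a 2-face are 2, hence even, so the parity argument of `walkAvoiding` applies.
    arc : ∀ {q x y a b} → Corner q x y → Joins x q a → Joins y q b →
          WalkIn (λ t → OnFace t q x y × t ≢ q) a b
    arc C jx jy =
      let open Corner C
          w , q∉w = walkAvoiding component
            (λ v∈ → cong parity (Face.valent twoFace _ v∈)) x∈component x≢y jx jy only
      in Star.map (Adjacent⇒whole component) w , λ t on → let on′ = On-map⁻ (Adjacent⇒whole component) w on in
           (C , On-Adjacent⇒∈ component (proj₂ (ends∈ component x∈component jx)) w on′) , λ { refl → q∉w on′ }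

  -- Two faces through q meet in a path, which has at most one edge unless the
  -- faces have two consecutive edges, hence their planes, in common.
  meet : ∀ {q x y z w t} → OnFace t q x y → OnFace t q z w → t ≢ q →
         (∃ λ g → (g ≡ x ⊎ g ≡ y) × (g ≡ z ⊎ g ≡ w) × Joins g q t) ⊎
         ((x ≡ z ⊎ x ≡ w) × (y ≡ z ⊎ y ≡ w))
  meet {q} {x} {y} {z} {w} {t} (C , t∈C) (D , t∈D) t≢q =
    [ (λ (_ , paths) → analyse (paths q t (x∈p∩q⁺ (C.q∈component , D.q∈component)) (x∈p∩q⁺ (t∈C , t∈D))))
    , (λ empty → contradiction (x∈p∩q⁺ (t∈C , t∈D)) (empty t)) ]′
    (meets C.twoFace D.twoFace)
    where
    module C = Corner C
    module D = Corner D

    M : Subgraph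
    M = C.component ⊓ D.component

    ∈M : ∀ {g} → g ∈ˢ edges M → g ∈ˢ edges C.component × g ∈ˢ edges D.component
    ∈M = x∈p∩q⁻ (edges C.component) (edges D.component)

    -- By 2-valence `g` and `g′` are all the edges of the first face at `v`, so their colours span
    -- its plane; both colours also lie in the plane of the second face.
    planes : ∀ {v g g′} → v ∈ˢ vertices C.component → g ∈ˢ edges M → g′ ∈ˢ edges M →
             Incident v g → Incident v g′ → g ≢ g′ → Span C.plane ⊆′ Span D.plane
    planes {v} {g} {g′} v∈ g∈ g′∈ i i′ g≢g′ ρ ρ∈ =
      Span-least (Span-isSubspace D.plane) (colours Γ α C.component v)
        (λ c∈ → let e , e∈ , eq = ∈-map⁻ α c∈ in subst (Span D.plane) (sym eq) (in-D e∈))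
        ρ (Equivalence.to (Face.spanning C.twoFace v v∈ ρ) ρ∈)
      where
      in-D : ∀ {e} → e ∈ edgesAt C.component v → Span D.plane (α e)
      in-D e∈ = [ (λ { refl → D.edge∈⁻ (proj₂ (∈M g∈)) }) , (λ { refl → D.edge∈⁻ (proj₂ (∈M g′∈)) }) ]′
        (pair-only (Face.valent C.twoFace v v∈)
          (∈-edgesAt⁺ C.component i (proj₁ (∈M g∈))) (∈-edgesAt⁺ C.component i′ (proj₁ (∈M g′∈))) g≢g′ e∈)

    analyse : Path M q t →
      (∃ λ g → (g ≡ x ⊎ g ≡ y) × (g ≡ z ⊎ g ≡ w) × Joins g q t) ⊎
      ((x ≡ z ⊎ x ≡ w) × (y ≡ z ⊎ y ≡ w))
    analyse record { walk = nil _ } = contradiction refl t≢q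
    analyse record { walk = cons g g∈ j (nil _) } = inj₁ (g ,
      C.only (proj₁ (∈M g∈)) (Joins⇒Incidentˡ j) , D.only (proj₂ (∈M g∈)) (Joins⇒Incidentˡ j) , j)
    analyse record { walk = cons g g∈ j (cons g′ g′∈ j′ rest) ; distinct = (_ ∷ q∉rest) ∷ _ } =
      -- One inclusion of planes is enough: the colours of `x` and `y` then lie in the second plane,
      -- whose only edges at `q` are `z` and `w`.
      inj₂ (D.plane-edges C.ix (C⊆D (α x) C.x∈plane) , D.plane-edges C.iy (C⊆D (α y) C.y∈plane))
      where
      C⊆D : Span C.plane ⊆′ Span D.plane
      C⊆D = planes (proj₂ (ends∈ C.component (proj₁ (∈M g∈)) j)) g∈ g′∈
        (Joins⇒Incidentʳ j) (Joins⇒Incidentˡ j′)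
        -- Were the two edges equal, the path would return to `q`.
        λ { refl → All.lookup q∉rest (start∈ rest) (Joins-unique (Joins-sym j) j′) }

  edgeAt : V → Fin n → E
  edgeAt p i = lookup (edgesAt whole p) (inject≤ i (≤-reflexive (sym (regular p ∈⊤))))

  edgeAt-incident : ∀ p i → Incident p (edgeAt p i)
  edgeAt-incident p i = proj₁ (∈-edgesAt⁻ whole
    (∈-lookup {xs = edgesAt whole p} (inject≤ i (≤-reflexive (sym (regular p ∈⊤))))))

  edgeAt-injective : ∀ p {i j} → edgeAt p i ≡ edgeAt p j → i ≡ j
  edgeAt-injective p eq = inject≤-injective _ _ _ _ (lookup-injective (Unique-edgesAt whole p) eq)

  module Bypass {q a b x y} (jx : Joins x q a) (jy : Joins y q b) (x≢y : x ≢ y) where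

    -- The n routes from a to b are indexed by the edges c at q: x stands for the
    -- route through q, and y for the one along the 2-face of x and y.
    data OnRoute (t : V) (c : E) : Set where
      spoke : c ≡ x → t ≡ a ⊎ t ≡ q ⊎ t ≡ b → OnRoute t c
      viaX  : t ≢ q → OnFace t q x c → OnRoute t c
      viaY  : t ≢ q → c ≢ x → OnFace t q y c → OnRoute t c

    route : ∀ c → Incident q c → WalkIn (λ t → OnRoute t c) a b
    route c ic with c ≟ x | c ≟ y
    ... | yes c≡x | _ = (x , ∈⊤ , Joins-sym jx) ◅ (y , ∈⊤ , jy) ◅ ε ,
      λ { t (inj₁ eq)        → spoke c≡x (inj₁ eq)
        ; t (inj₂ (inj₁ eq)) → spoke c≡x (inj₂ (inj₁ eq))
        ; t (inj₂ (inj₂ eq)) → spoke c≡x (inj₂ (inj₂ eq)) }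
    ... | no _ | yes refl = relax
      (arc record { ix = Joins⇒Incidentˡ jx ; iy = ic ; x≢y = x≢y } jx jy)
      (λ (f , t≢q) → viaX t≢q f)
    -- The arcs in the faces of `x`, `c` and of `y`, `c` both end at the far end of `c`, where they
    -- are joined.
    ... | no c≢x | no c≢y = relax
      (join (arc record { ix = Joins⇒Incidentˡ jx ; iy = ic ; x≢y = c≢x ∘ sym } jx (proj₂ (opposite ic)))
            (arc record { ix = Joins⇒Incidentˡ jy ; iy = ic ; x≢y = c≢y ∘ sym } jy (proj₂ (opposite ic))))
      [ (λ (f , t≢q) → viaX t≢q f) , (λ (f , t≢q) → viaY t≢q c≢x f) ]′

    private
      spoke-disjoint : ∀ {t c c′} → c ≢ c′ → c ≡ x → t ≡ a ⊎ t ≡ q ⊎ t ≡ b → OnRoute t c′ → t ≡ a ⊎ t ≡ b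
      spoke-disjoint c≢c′ _    (inj₁ t≡a)        _              = inj₁ t≡a
      spoke-disjoint c≢c′ _    (inj₂ (inj₂ t≡b)) _              = inj₂ t≡b
      spoke-disjoint c≢c′ refl (inj₂ (inj₁ _))   (spoke refl _) = contradiction refl c≢c′
      spoke-disjoint c≢c′ _    (inj₂ (inj₁ t≡q)) (viaX t≢q _)   = contradiction t≡q t≢q
      spoke-disjoint c≢c′ _    (inj₂ (inj₁ t≡q)) (viaY t≢q _ _) = contradiction t≡q t≢q

      -- Both faces contain `z`, so by `meet` they share nothing off `q` except its far end.
      same-side-disjoint : ∀ {t c c′ z d} → c ≢ c′ → t ≢ q → Joins z q d →
                           OnFace t q z c → OnFace t q z c′ → t ≡ d
      same-side-disjoint c≢c′ t≢q jz onC@(C , _) onD with meet onC onD t≢q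
      ... | inj₁ (_ , inj₁ refl , _         , j) = Joins-unique j jz
      ... | inj₁ (_ , inj₂ refl , inj₁ refl , _) = contradiction refl (Corner.x≢y C)
      ... | inj₁ (_ , inj₂ refl , inj₂ refl , _) = contradiction refl c≢c′
      ... | inj₂ (_ , inj₁ refl)                 = contradiction refl (Corner.x≢y C)
      ... | inj₂ (_ , inj₂ refl)                 = contradiction refl c≢c′

      -- With `c′` different from `x` and from `c`, the faces can share an edge at `q` only if `c`
      -- is `y`, and the far end of `y` is `b`.
      cross-disjoint : ∀ {t c c′} → c ≢ c′ → c′ ≢ x → t ≢ q → OnFace t q x c → OnFace t q y c′ → t ≡ b
      cross-disjoint c≢c′ c′≢x t≢q onC onD with meet onC onD t≢q
      ... | inj₁ (_ , inj₁ refl , inj₁ refl , _) = contradiction refl x≢y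
      ... | inj₁ (_ , inj₁ refl , inj₂ refl , _) = contradiction refl c′≢x
      ... | inj₁ (_ , inj₂ refl , inj₁ refl , j) = Joins-unique j jy
      ... | inj₁ (_ , inj₂ refl , inj₂ refl , _) = contradiction refl c≢c′
      ... | inj₂ (inj₁ refl , _)                 = contradiction refl x≢y
      ... | inj₂ (inj₂ refl , _)                 = contradiction refl c′≢x

    routes-disjoint : ∀ {t c c′} → c ≢ c′ → OnRoute t c → OnRoute t c′ → t ≡ a ⊎ t ≡ b
    routes-disjoint c≢c′ (spoke c≡x t∈)     on               = spoke-disjoint c≢c′ c≡x t∈ on
    routes-disjoint c≢c′ on                 (spoke c′≡x t∈)  = spoke-disjoint (c≢c′ ∘ sym) c′≡x t∈ on
    routes-disjoint c≢c′ (viaX t≢q onC)     (viaX _ onD)     = inj₁ (same-side-disjoint c≢c′ t≢q jx onC onD)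
    routes-disjoint c≢c′ (viaY t≢q _ onC)   (viaY _ _ onD)   = inj₂ (same-side-disjoint c≢c′ t≢q jy onC onD)
    routes-disjoint c≢c′ (viaX t≢q onC)     (viaY _ c′≢x onD) = inj₂ (cross-disjoint c≢c′ c′≢x t≢q onC onD)
    routes-disjoint c≢c′ (viaY t≢q c≢x onC) (viaX _ onD)     = inj₂ (cross-disjoint (c≢c′ ∘ sym) c≢x t≢q onD onC)

  -- The list `ts` may contain `q`: the route through `q` is just one of the `n`, and fewer than `n`
  -- vertices cannot hit them all. If `x` and `y` coincide, so do `a` and `b`, and the trivial walk
  -- serves.
  bypass : ∀ {q a b x y} → Joins x q a → Joins y q b →
           ∀ {ts} → length ts < n → a ∉ ts → b ∉ ts → WalkIn (_∉ ts) a b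
  bypass {q} {x = x} {y} jx jy ts<n a∉ b∉ with x ≟ y
  ... | yes refl with refl ← Joins-unique jx jy = ε , λ { t refl → a∉ }
  ... | no x≢y =
    let open Bypass jx jy x≢y
        walk i = route (edgeAt q i) (edgeAt-incident q i)
        i , clean = someWalkAvoids (λ i → proj₁ (walk i))
          (λ i j i≢j t on on′ → routes-disjoint (i≢j ∘ edgeAt-injective q)
            (proj₂ (walk i) t on) (proj₂ (walk j) t on′)) ts<n a∉ b∉
    in proj₁ (walk i) , clean

  -- Rerouting walks around finitely many vertices

  ∉-∷ : ∀ {s t : V} {ts} → t ≢ s → t ∉ ts → t ∉ s ∷ ts
  ∉-∷ t≢s t∉ (here t≡s) = t≢s t≡s
  ∉-∷ t≢s t∉ (there t∈) = t∉ t∈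

  -- Each visit to `s` lies between two neighbours of `s`, which a bypass connects while avoiding
  -- the whole list; so no vertex of `ts` is met again. There are no loops, hence the vertex after
  -- `s` is not `s` and the recursion can continue from it.
  reroute : ∀ {s ts u r} → length (s ∷ ts) < n → u ≢ s → r ≢ s →
            (w : Star (Adjacent whole) u r) → (∀ t → t On w → t ∉ ts) → WalkIn (_∉ s ∷ ts) u r
  reroute <n u≢s r≢s ε clean = ε , λ { t refl → ∉-∷ u≢s (clean t refl) }
  reroute {s} <n u≢s r≢s (_◅_ {j = v} step@(x , _ , jx) w) clean with v ≟ s
  ... | no v≢s = let w′ , clean′ = reroute <n v≢s r≢s w (λ t → clean t ∘ inj₂) in
    step ◅ w′ , λ { t (inj₁ refl) → ∉-∷ u≢s (clean t (inj₁ refl)) ; t (inj₂ on) → clean′ t on }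
  ... | yes refl with w
  ...   | ε = contradiction refl r≢s
  ...   | _◅_ {j = v′} (y , _ , jy) w₂ =
    let v′≢s        = Joins⇒≢ jy ∘ sym
        w₁ , clean₁  = bypass (Joins-sym jx) jy <n (∉-∷ u≢s (clean _ (inj₁ refl)))
                         (∉-∷ v′≢s (clean v′ (inj₂ (inj₂ (On-start w₂)))))
        w₂′ , clean₂ = reroute <n v′≢s r≢s w₂ (λ t → clean t ∘ inj₂ ∘ inj₂)
    in w₁ ◅◅ w₂′ , λ t on → [ clean₁ t , clean₂ t ]′ (On-◅◅⁻ w₁ on)

  avoiding : ∀ ts → length ts < n → ∀ {p r} → p ∉ ts → r ∉ ts → WalkIn (_∉ ts) p r
  avoiding [] _ {p} {r} _ _ = fromWalk (Path.walk (proj₂ connected p r ∈⊤ ∈⊤)) , λ _ _ ()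
  avoiding (s ∷ ts) <n p∉ r∉ =
    let w , clean = avoiding ts (<⇒≤ <n) (p∉ ∘ there) (r∉ ∘ there) in
    reroute <n (p∉ ∘ here) (r∉ ∘ here) w clean

  -- Disjoint paths between adjacent and nonadjacent vertices

  DisjointPaths : V → V → Set
  DisjointPaths p q = ∃ λ (P : Fin n → Path whole p q) → ∀ i j → i ≢ j → Disjoint (P i) (P j)

  -- Besides `e` itself, each edge `c` at `p` gives a path: `c`, followed by the arc off `p` in the
  -- face of `c` and `e`. All these faces contain `e`, so off `p` they share only `q`.
  adjacent-connected : ∀ {e p q} → Joins e p q → DisjointPaths p q
  adjacent-connected {e} {p} {q} je = (λ i → proj₁ (path i)) ,
    λ i j i≢j → vertices-disjoint i j i≢j , edges-disjoint i j i≢j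
    where
    pathThrough : ∀ c → Incident p c → ∃ λ (P : Path whole p q) →
      (∀ t → t ∈ Path.pathVertices P → (t ≡ p ⊎ t ≡ q) ⊎ t ≢ p × OnFace t p c e) ×
      (∀ g → g ∈ Path.pathEdges P → Incident p g → g ≡ c)
    pathThrough c ic with c ≟ e
    ... | yes refl =
      let P , vs , es = eraseLoops (cons c ∈⊤ je (nil ∈⊤)) in
      P , (λ t t∈ → inj₁ (onEdge (vs t t∈))) , λ g g∈ _ → isEdge (es g g∈)
      where
      onEdge : ∀ {t} → t ∈ p ∷ q ∷ [] → t ≡ p ⊎ t ≡ q
      onEdge (here eq)         = inj₁ eq
      onEdge (there (here eq)) = inj₂ eq
      isEdge : ∀ {g} → g ∈ c ∷ [] → g ≡ c
      isEdge (here eq) = eq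
    ... | no c≢e =
      let a , jc      = opposite ic
          w , sub     = arc record { ix = ic ; iy = Joins⇒Incidentˡ je ; x≢y = c≢e } jc je
          w′ , sub′   = toWalk ∈⊤ w
          P , vs , es = eraseLoops (cons c ∈⊤ jc w′)
      in P
       , (λ t t∈ → onWalk w′ (λ t∈′ → let on , t≢p = sub t (sub′ t t∈′) in t≢p , on) (vs t t∈))
       , λ g g∈ ig → firstEdge w′ (λ g∈′ → proj₂ (sub p (sub′ p (edge-ends∈ w′ g∈′ ig))) refl) (es g g∈)
      where
      onWalk : ∀ {a t} {A : Set} (w : Walk whole a q) → (t ∈ walkVertices w → A) →
               t ∈ p ∷ walkVertices w → (t ≡ p ⊎ t ≡ q) ⊎ A
      onWalk w f (here eq)  = inj₁ (inj₁ eq)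
      onWalk w f (there t∈) = inj₂ (f t∈)
      firstEdge : ∀ {a g} (w : Walk whole a q) → ¬ (g ∈ walkEdges w) → g ∈ c ∷ walkEdges w → g ≡ c
      firstEdge w g∉ (here eq)  = eq
      firstEdge w g∉ (there g∈) = contradiction g∈ g∉

    path : ∀ i → _
    path i = pathThrough (edgeAt p i) (edgeAt-incident p i)

    faces-disjoint : ∀ {t c c′} → c ≢ c′ → t ≢ p → OnFace t p c e → OnFace t p c′ e → t ≡ q
    faces-disjoint c≢c′ t≢p onC@(C , _) onD@(D , _) with meet onC onD t≢p
    ... | inj₁ (_ , inj₁ refl , inj₁ refl , _) = contradiction refl c≢c′
    ... | inj₁ (_ , inj₁ refl , inj₂ refl , _) = contradiction refl (Corner.x≢y C)
    ... | inj₁ (_ , inj₂ refl , _         , j) = Joins-unique j je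
    ... | inj₂ (inj₁ refl , _)                 = contradiction refl c≢c′
    ... | inj₂ (inj₂ refl , _)                 = contradiction refl (Corner.x≢y C)

    vertices-disjoint : ∀ i j → i ≢ j → ∀ t → t ∈ Path.pathVertices (proj₁ (path i)) →
                        t ∈ Path.pathVertices (proj₁ (path j)) → t ≡ p ⊎ t ≡ q
    vertices-disjoint i j i≢j t t∈ t∈′ with proj₁ (proj₂ (path i)) t t∈ | proj₁ (proj₂ (path j)) t t∈′
    ... | inj₁ eq          | _              = eq
    ... | inj₂ _           | inj₁ eq        = eq
    ... | inj₂ (t≢p , onC) | inj₂ (_ , onD) = inj₂ (faces-disjoint (i≢j ∘ edgeAt-injective p) t≢p onC onD)

    -- A shared edge has both ends among `p` and `q`, hence is incident with `p`; but the only edge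
    -- of a path at `p` is the one indexing it.
    edges-disjoint : ∀ i j → i ≢ j → ∀ g → g ∈ Path.pathEdges (proj₁ (path i)) →
                     ¬ (g ∈ Path.pathEdges (proj₁ (path j)))
    edges-disjoint i j i≢j g g∈ g∈′ = i≢j (edgeAt-injective p
      (trans (sym (proj₂ (proj₂ (path i)) g g∈ ig)) (proj₂ (proj₂ (path j)) g g∈′ ig)))
      where
      atEnd : ∀ {v} → Incident v g → v ≡ p ⊎ v ≡ q
      atEnd iv = vertices-disjoint i j i≢j _ (edge-ends∈ (Path.walk (proj₁ (path i))) g∈ iv)
                                           (edge-ends∈ (Path.walk (proj₁ (path j))) g∈′ iv)
      ig : Incident p g
      ig with atEnd (inj₁ refl) | atEnd (inj₂ refl)
      ... | inj₁ s | _      = inj₁ s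
      ... | inj₂ _ | inj₁ t = inj₂ t
      ... | inj₂ s | inj₂ t = contradiction (trans s (sym t)) (loopless g)

  nonadjacent-inseparable : ∀ {p q} → p ≢ q → ¬ Adjacent whole p q → ∀ {m} (T : Fin m → V) → m < n →
    ¬ Separates (Adjacent whole) (Adjacent whole p) (λ v → Adjacent whole v q) T
  nonadjacent-inseparable {p} {q} p≢q ¬pq T m<n separates =
    let w , clean                     = avoiding ts <n
          (λ p∈ → proj₁ (proj₂ (∈-filter⁻ ends? {xs = tabulate T} p∈)) refl)
          (λ q∈ → proj₂ (proj₂ (∈-filter⁻ ends? {xs = tabulate T} q∈)) refl)
        a , b , w′ , pa , bq , inside = interior p≢q ¬pq w
        j , on                        = separates w′ pa bq
        on′ , t≢p,q                   = inside (T j) on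
    in clean (T j) on′ (∈-filter⁺ ends? (∈-tabulate⁺ j) t≢p,q)
    where
    ends? : Decidable (λ t → t ≢ p × t ≢ q)
    ends? t = ¬? (t ≟ p) ×-dec ¬? (t ≟ q)

    -- A separator of the two neighbourhoods may contain `p` or `q`, which no walk from `p` to `q`
    -- avoids. These entries are dropped, and `interior` keeps the trimmed walk off `p` and `q`.
    ts : List V
    ts = filter ends? (tabulate T)

    <n : length ts < n
    <n = ≤-<-trans (length-filter ends? (tabulate T)) (subst (_< n) (sym (length-tabulate T)) m<n)

  nonadjacent-connected : ∀ {p q} → p ≢ q → ¬ Adjacent whole p q → DisjointPaths p q
  nonadjacent-connected {p} {q} p≢q ¬pq
    with menger (adjacent? whole) (adjacent? whole p) (λ v → adjacent? whole v q) n
  ... | inj₂ (_ , T , m<n , separates) = ⊥-elim (nonadjacent-inseparable p≢q ¬pq T m<n separates)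
  ... | inj₁ L = P , λ i j i≢j → vertices-disjoint i j i≢j , edges-disjoint i j i≢j
    where
    open Linkage L

    full : ∀ i → Star (Adjacent whole) p q
    full i = start∈A i ◅ walk i ◅◅ end∈B i ◅ ε

    On-full : ∀ i {t} → t On full i → (t ≡ p ⊎ t ≡ q) ⊎ t On walk i
    On-full i (inj₁ t≡p) = inj₁ (inj₁ t≡p)
    On-full i (inj₂ on) with On-◅◅⁻ (walk i) on
    ... | inj₁ on′         = inj₂ on′
    ... | inj₂ (inj₁ refl) = inj₂ (On-end (walk i))
    ... | inj₂ (inj₂ t≡q)  = inj₁ (inj₂ t≡q)

    -- A walk of the linkage may itself run through `p` or `q`; erasing loops removes the
    -- repetition.
    P : Fin n → Path whole p q
    P i = proj₁ (eraseLoops (proj₁ (toWalk ∈⊤ (full i))))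

    On-P : ∀ i {t} → t ∈ Path.pathVertices (P i) → (t ≡ p ⊎ t ≡ q) ⊎ t On walk i
    On-P i t∈ = On-full i (proj₂ (toWalk ∈⊤ (full i)) _
      (proj₁ (proj₂ (eraseLoops (proj₁ (toWalk ∈⊤ (full i))))) _ t∈))

    vertices-disjoint : ∀ i j → i ≢ j → ∀ t →
                        t ∈ Path.pathVertices (P i) → t ∈ Path.pathVertices (P j) → t ≡ p ⊎ t ≡ q
    vertices-disjoint i j i≢j t t∈ t∈′ with On-P i t∈ | On-P j t∈′
    ... | inj₁ eq  | _        = eq
    ... | inj₂ _   | inj₁ eq  = eq
    ... | inj₂ on  | inj₂ on′ = contradiction (disjoint i j t on on′) i≢j

    -- A shared edge would have its ends among `p` and `q`, and so would join these nonadjacent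
    -- vertices.
    edges-disjoint : ∀ i j → i ≢ j → ∀ g → g ∈ Path.pathEdges (P i) → ¬ (g ∈ Path.pathEdges (P j))
    edges-disjoint i j i≢j g g∈ g∈′ = ¬pq (joined (atEnd (inj₁ refl)) (atEnd (inj₂ refl)))
      where
      atEnd : ∀ {v} → Incident v g → v ≡ p ⊎ v ≡ q
      atEnd iv = vertices-disjoint i j i≢j _ (edge-ends∈ (Path.walk (P i)) g∈ iv)
                                             (edge-ends∈ (Path.walk (P j)) g∈′ iv)
      joined : src g ≡ p ⊎ src g ≡ q → tgt g ≡ p ⊎ tgt g ≡ q → Adjacent whole p q
      joined (inj₁ s) (inj₂ t) = g , ∈⊤ , inj₁ (s , t)
      joined (inj₂ s) (inj₁ t) = g , ∈⊤ , inj₂ (s , t)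
      joined (inj₁ s) (inj₁ t) = contradiction (trans s (sym t)) (loopless g)
      joined (inj₂ s) (inj₂ t) = contradiction (trans s (sym t)) (loopless g)

  multiplyConnected : MultiplyConnected n
  multiplyConnected p q p≢q with adjacent? whole p q
  ... | yes (_ , _ , j) = adjacent-connected j
  ... | no ¬pq          = nonadjacent-connected p≢q ¬pq

proposition3p4 : ∀ {k n : ℕ} (S : Skeleton k n) →
    let Γ = Skeleton.Γ S in
    Graph.Connected Γ (Graph.whole Γ) →
    ∃ (λ l → 3 ≤ l × l ≤ k × Independent S l) →
    (∀ {d d′ : ℕ} → d < 3 → d′ < 3 → (F : Face S d) (F′ : Face S d′) →
    Graph.Connected Γ (_∩ᶠ_ S F F′) ⊎ Graph.Empty Γ (_∩ᶠ_ S F F′)) →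
    Graph.MultiplyConnected Γ n
proposition3p4 S connected (suc (suc (suc l)) , _ , l≤k , independent) meets =
  Connectivity.multiplyConnected S l≤k independent connected (meets ≤-refl ≤-refl)
proposition3p4 S connected (suc (suc zero) , s≤s (s≤s ()) , _) meets
proposition3p4 S connected (suc zero , s≤s () , _) meets
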